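{- Let $\mathcal R = (\Sigma, E, R)$ be a rewrite theory with a given set of strategy definitions, let $\alpha$ be a strategy expression and $t$ a ground term. If the set $\{ q \in \mathcal{XS} : t \mathbin{@} \alpha \to_{s,c}^* q \}$ of reachable execution states from $t \mathbin{@} \alpha$ is finite, then $E(\alpha, t)$ is a closed $\infty$-regular language.
   Context: **Languages.** A language $L$ of finite and infinite words over an alphabet $A$ is closed if it contains all its accumulation points, where an infinite word $w$ is an accumulation point of $L$ if for every $n\in\mathbb N$ some word in $L$ has the length-$n$ prefix of $w$ as a prefix. $L$ is $\infty$-regular if its finite words form a regular language and its infinite words form an $\omega$-regular language (recognized by a nondeterministic Büchi automaton), over a finite alphabet. Here letters are terms. **Rewriting.** $\mathcal R = (\Sigma, E, R)$ is a rewrite theory over a membership equational theory $(\Sigma,E)$, with labeled rules, possibly conditional, with condition fragments that are equations, sort memberships, or rewriting conditions $l \Rightarrow p$. Terms are considered modulo $E$, and $T_\Sigma$ denotes ground terms (modulo $E$). $t \to^1_R t'$ is one-step rewriting. **Strategy expressions.** Core grammar: $\alpha ::= \mathtt{idle} \mid \mathtt{fail} \mid \mathtt{match}\,P\,\mathtt{s.t.}\,C \mid \alpha;\alpha \mid \alpha|\alpha \mid \alpha^* \mid \alpha\,?\,\alpha:\alpha \mid \mathtt{matchrew}\,P\,\mathtt{s.t.}\,C\,\mathtt{by}\,x_1\,\mathtt{using}\,\alpha_1,\ldots,x_n\,\mathtt{using}\,\alpha_n \mid sl(t_1,\ldots,t_n) \mid \mathtt{all} \mid rl[\rho]\{\alpha_1,\ldots,\alpha_m\}$,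 where $C$ is an equational condition, $rl$ is a rule label, $\rho$ is an optional initial substitution $x_1 \leftarrow t_1,\ldots$, the list of $m\ge0$ strategies is for a rule with $m$ rewriting conditions, and $sl$ is a strategy name given by definitions $sl(p_1,\ldots,p_n) := \delta$ (optionally: if an equational condition holds), which may be mutually recursive. Rule applications may be wrapped in $\mathtt{top}(\cdot)$ to apply only at the root. (Variants $\mathtt{amatch}$, $\mathtt{amatchrew}$ match at any position; $\mathtt{xmatch}$, $\mathtt{xmatchrew}$ match with extension.) Other combinators are abbreviations. **Execution states** $\mathcal{XS}$: $q ::= t \mathbin{@} s \mid \mathrm{subterm}(x_1:q_1,\ldots,x_n:q_n;t)\mathbin{@} s \mid \mathrm{rewc}(p:q,\sigma,C,\vec\alpha,\theta,r,c;t)\mathbin{@} s$, with stacks $s ::= \varepsilon \mid \alpha s \mid \theta s$ of strategy expressions $\alpha$ and substitutions $\theta$. $\mathrm{vctx}(\theta s)=\theta$, $\mathrm{vctx}(\varepsilon)=\mathrm{id}$, $\mathrm{vctx}(\alpha s)=\mathrm{vctx}(s)$. Current term: $\mathrm{cterm}(t\mathbin{@} s)=t$, $\mathrm{cterm}(\mathrm{rewc}(\ldots;t)\mathbin{@} s)=t$, $\mathrm{cterm}(\mathrm{subterm}(x_1:q_1,\ldots,x_n:q_n;t)\mathbin{@} s)=t[x_1/\mathrm{cterm}(q_1),\ldots,x_n/\mathrm{cterm}(q_n)]$. States $t\mathbin{@}\varepsilon$ are solutions. **Transitions** ($\to_c$ control, $\to_s$ system, $\to_{s,c} = \to_s\cup\to_c$),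 where $\theta=\mathrm{vctx}(s)$ instantiates the variables of the expressions: - $t\mathbin{@}\mathtt{idle}\,s\to_c t\mathbin{@} s$; no rule for $\mathtt{fail}$; $t\mathbin{@}\theta' s\to_c t\mathbin{@} s$ (popping a substitution). - $t\mathbin{@}(\mathtt{match}\,P\,\mathtt{s.t.}\,C)\,s\to_c t\mathbin{@} s$ if $t$ matches $P$ satisfying $C$. - $t\mathbin{@}(\alpha;\beta)s\to_c t\mathbin{@}\alpha\beta s$; $t\mathbin{@}(\alpha|\beta)s\to_c t\mathbin{@}\alpha s$ and $\to_c t\mathbin{@}\beta s$; $t\mathbin{@}\alpha^* s\to_c t\mathbin{@} s$ and $\to_c t\mathbin{@}\alpha\,\alpha^* s$. - $t\mathbin{@}(\alpha?\beta:\gamma)s\to_c t\mathbin{@}\alpha\beta s$; and $t\mathbin{@}(\alpha?\beta:\gamma)s\to_c t\mathbin{@}\gamma s$ if $\to_{s,c}$ is terminating from $t\mathbin{@}\alpha\theta$ and reaches no solution from it. - $t\mathbin{@}\mathtt{all}\,s\to_s t'\mathbin{@} s$ if $t\to^1_R t'$. For a rule labeled $rl$ without rewriting conditions, $t\mathbin{@} rl[\rho]s\to_s t'\mathbin{@} s$ for each $t'$ obtained from $t$ by applying, at some position, that rule instantiated first by $\rho$ (whose terms are instantiated by $\theta$). - For a rule labeled $rl$ with right-hand side $r$ and condition $C_0\wedge l_1\Rightarrow p_1\wedge C'$ with $C_0$ equational and $m\ge1$ rewriting fragments in total: $t\mathbin{@} rl[\rho]\{\alpha_1,\ldots,\alpha_m\}s\to_c\mathrm{rewc}(p_1:\sigma(l_1)\mathbin{@}\alpha_1\theta,\sigma,C',\alpha_2\cdots\alpha_m,\theta,r,c;t)\mathbin{@}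 s$ for each context $c$ and substitution $\sigma$ (extending $\rho$) matching the left-hand side in $t$ and satisfying $C_0$. If $q\to_s q'$ or $q\to_c q'$, then $\mathrm{rewc}(p:q,\ldots)\mathbin{@} s\to_c\mathrm{rewc}(p:q',\ldots)\mathbin{@} s$. For each $\sigma'$ extending $\sigma$ with $\sigma'(p)=t'$ and satisfying the equational condition $C_0$: $\mathrm{rewc}(p:t'\mathbin{@}\varepsilon,\sigma,C_0\wedge l\Rightarrow p'\wedge C,\alpha\vec\alpha,\theta,r,c;t)\mathbin{@} s\to_c\mathrm{rewc}(p':\sigma'(l)\mathbin{@}\alpha\theta,\sigma',C,\vec\alpha,\theta,r,c;t)\mathbin{@} s$, and, when no rewriting fragment remains, $\mathrm{rewc}(p:t'\mathbin{@}\varepsilon,\sigma,C_0,\ldots,r,c;t)\mathbin{@} s\to_s c(\sigma'(r))\mathbin{@} s$. - $t\mathbin{@}(\mathtt{matchrew}\,P\,\mathtt{s.t.}\,C\,\mathtt{by}\,x_1\,\mathtt{using}\,\alpha_1,\ldots)s\to_c\mathrm{subterm}(x_1:\sigma(x_1)\mathbin{@}\alpha_1\sigma,\ldots,x_n:\sigma(x_n)\mathbin{@}\alpha_n\sigma;\sigma_{ -\{x_1,\ldots,x_n\}}(P))\mathbin{@} s$ for each match $\sigma$ of $t$ with $P$ satisfying $C$ and extending $\theta$ ($\sigma_{ -X}$ leaves the variables in $X$ untouched). If $q_i\to_\bullet q_i'$ with $\bullet\in\{s,c\}$, then $\mathrm{subterm}(\ldots,x_i:q_i,\ldots;t)\mathbin{@}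 s\to_\bullet\mathrm{subterm}(\ldots,x_i:q_i',\ldots;t)\mathbin{@} s$. $\mathrm{subterm}(x_1:t_1\mathbin{@}\varepsilon,\ldots,x_n:t_n\mathbin{@}\varepsilon;t)\mathbin{@} s\to_c t[x_1/t_1,\ldots,x_n/t_n]\mathbin{@} s$. - $t\mathbin{@} sl(t_1,\ldots,t_n)s\to_c t\mathbin{@}\delta\sigma s$ for every definition whose left-hand side matches the call instantiated by $\theta$, with substitution $\sigma$ (and condition satisfied), $\delta$ being its right-hand side; if the top of $s$ is a substitution, it is replaced by $\sigma$ (tail call). **Denotation.** $\twoheadrightarrow$ is $\to_c^*$ followed by one $\to_s$. $\mathrm{Ex}^*(\alpha,t)=\{q_0\cdots q_n: q_0=t\mathbin{@}\alpha,\ q_k\twoheadrightarrow q_{k+1},\ q_n\to_c^* t'\mathbin{@}\varepsilon \text{ for some } t'\in T_\Sigma\}$, $\mathrm{Ex}^\omega(\alpha,t)=\{(q_k)_{k\ge0}: q_0=t\mathbin{@}\alpha,\ q_k\twoheadrightarrow q_{k+1}\}$, and $E(\alpha,t)=\mathrm{cterm}(\mathrm{Ex}^*(\alpha,t)\cup\mathrm{Ex}^\omega(\alpha,t))$ (cterm applied letterwise). -}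

module Defs where

open import Axiom.ExcludedMiddle using (ExcludedMiddle)
open import Data.Bool using (Bool; if_then_else_)
open import Data.Empty using (⊥; ⊥-elim)
open import Data.Fin using (Fin)
open import Data.Fin.Subset using (Subset; _∈_)
open import Data.List using (List; []; _∷_; map; applyUpTo)
open import Data.List.Membership.Propositional renaming (_∈_ to _∈ₗ_; _∉_ to _∉ₗ_)
open import Data.List.Relation.Binary.Pointwise as Pointwise using (Pointwise; []; _∷_)
open import Data.List.Relation.Binary.Prefix.Heterogeneous using (Prefix)
open import Data.List.Relation.Unary.All as All using (All; []; _∷_; _[_]≔_)
open import Data.List.Relation.Unary.Any using (Any; here; there)
open import Data.Maybe using (Maybe; just; nothing; Is-just)
import Data.Maybe.Relation.Binary.Pointwise as Maybe
open import Data.Nat using (ℕ; suc; _≤_)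
open import Data.Product using (Σ; ∃; ∃₂; Σ-syntax; ∃-syntax; _×_; _,_; proj₁; proj₂)
open import Data.Sum using (_⊎_; inj₁; inj₂)
open import Data.Vec using (Vec; []; _∷_)
open import Function.Base using (flip; _∘_)
open import Function.Bundles using (_⇔_; mk⇔; module Equivalence)
open import Function.Definitions using (Injective)
open import Induction.WellFounded using (Acc; acc)
open import Level using (0ℓ)
open import Relation.Binary.Bundles using (Setoid)
open import Relation.Binary.Construct.Closure.ReflexiveTransitive using (Star; ε; _◅_)
open import Relation.Binary.PropositionalEquality as ≡ using (_≡_; refl)
open import Relation.Nullary using (¬_; yes; no)

-- Letters are the elements of a setoid, since the letters of interest are
-- terms modulo equations.
module Words (A : Setoid 0ℓ 0ℓ) where
  open Setoid A using (_≈_) renaming (Carrier to Letter)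

  record Language : Set₁ where
    field
      finite   : List Letter → Set
      infinite : (ℕ → Letter) → Set

  -- Some word of L starts with the first n letters of w.
  HasPrefix : Language → (ℕ → Letter) → ℕ → Set
  HasPrefix L w n =
      (Σ[ u ∈ List Letter ] Language.finite L u × Prefix _≈_ (applyUpTo w n) u)
    ⊎ (Σ[ v ∈ (ℕ → Letter) ] Language.infinite L v
                             × Pointwise _≈_ (applyUpTo w n) (applyUpTo v n))

  AccumulationPoint : Language → (ℕ → Letter) → Set
  AccumulationPoint L w = ∀ n → HasPrefix L w n

  -- Already for languages of finite automata, closedness is a form of weak
  -- König's lemma, hence a classical statement.
  Closed : Language → Set
  Closed L = ∀ w → AccumulationPoint L w → Language.infinite L w

-- Used both as an automaton on finite words and as a Büchi automaton.
record Automaton (m : ℕ) : Set where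
  field
    size      : ℕ
    initial   : Subset size
    accepting : Subset size
    δ         : Fin size → Fin m → Subset size

  data Accepts (p : Fin size) : List (Fin m) → Set where
    []  : p ∈ accepting → Accepts p []
    _∷_ : ∀ {a w q} → q ∈ δ p a → Accepts q w → Accepts p (a ∷ w)

  Recognises : List (Fin m) → Set
  Recognises w = ∃[ p ] p ∈ initial × Accepts p w

  BüchiRecognises : (ℕ → Fin m) → Set
  BüchiRecognises w =
    Σ[ ρ ∈ (ℕ → Fin size) ] ρ 0 ∈ initial
                          × (∀ i → ρ (suc i) ∈ δ (ρ i) (w i))
                          × (∀ i → ∃[ j ] i ≤ j × ρ j ∈ accepting)

module Regularity (A : Setoid 0ℓ 0ℓ) where
  open Setoid A using (_≈_) renaming (Carrier to Letter)
  open Words A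

  -- The finite alphabet is presented as an injection of Fin m into the letters.
  record ∞-Regular (L : Language) : Set where
    open Language L
    field
      {m}              : ℕ
      letter           : Fin m → Letter
      letter-injective : Injective _≡_ _≈_ letter
      nfa              : Automaton m
      regular   : ∀ w → finite w ⇔
        (Σ[ v ∈ List (Fin m) ] Pointwise _≈_ w (map letter v) × Automaton.Recognises nfa v)
      büchi            : Automaton m
      ω-regular : ∀ w → infinite w ⇔
        (Σ[ v ∈ (ℕ → Fin m) ] (∀ i → w i ≈ letter (v i)) × Automaton.BüchiRecognises büchi v)

-- Variables range over kinds, as in membership equational logic; a variable of
-- a sort s is a variable of the kind of s together with a membership condition.
record Signature : Set₁ where
  field
    Kind : Set
    Sort : Kind → Set
    Op   : List Kind → Kind → Set
    Var  : Kind → Set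

module Terms (S : Signature) where
  open Signature S public

  Family : Set₁
  Family = Kind → Set

  private variable
    k k′ k₀ : Kind
    ks      : List Kind
    X Y     : Family

  mutual
    data Term (X : Family) : Kind → Set where
      var : X k → Term X k
      op  : Op ks k → Args X ks → Term X k

    data Args (X : Family) : List Kind → Set where
      []  : Args X []
      _∷_ : Term X k → Args X ks → Args X (k ∷ ks)

  Ground : Kind → Set
  Ground = Term (λ _ → ⊥)

  Pattern : Kind → Set
  Pattern = Term Var

  mutual
    bind : (∀ {k} → X k → Term Y k) → Term X k → Term Y k
    bind f (var x)   = f x
    bind f (op g ts) = op g (binds f ts)

    binds : (∀ {k} → X k → Term Y k) → Args X ks → Args Y ks
    binds f []       = []
    binds f (t ∷ ts) = bind f t ∷ binds f ts

  ⌜_⌝ : Ground k → Term Y k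
  ⌜_⌝ = bind λ ()

  -- A term with a hole of kind k₀; it is a context when the hole occurs once.
  Holed : Kind → Kind → Set
  Holed k₀ = Term (k₀ ≡_)

  _[_] : Holed k₀ k → Term Y k₀ → Term Y k
  c [ t ] = bind (λ { refl → t }) c

  mutual
    data OneHole {k₀} : Holed k₀ k → Set where
      here : OneHole (var refl)
      op   : (f : Op ks k) {cs : Args (k₀ ≡_) ks} → OneHoles cs → OneHole (op f cs)

    data OneHoles {k₀} : Args (k₀ ≡_) ks → Set where
      here  : {c : Holed k₀ k} (ts : Args (λ _ → ⊥) ks) →
              OneHole c → OneHoles (c ∷ binds (λ ()) ts)
      there : {cs : Args (k₀ ≡_) ks} (t : Ground k) →
              OneHoles cs → OneHoles (⌜ t ⌝ ∷ cs)

  mutual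
    data _occursIn_ (x : X k) : Term X k′ → Set where
      var : x occursIn var x
      op  : {f : Op ks k′} {ts : Args X ks} → x occursInArgs ts → x occursIn op f ts

    data _occursInArgs_ (x : X k) : Args X ks → Set where
      here  : {t : Term X k′} {ts : Args X ks} → x occursIn t → x occursInArgs (t ∷ ts)
      there : {t : Term X k′} {ts : Args X ks} → x occursInArgs ts → x occursInArgs (t ∷ ts)

  -- Substitutions are partial: a match binds exactly the variables it has to,
  -- and kinds without ground terms do no harm.
  Substitution : Family → Set
  Substitution Y = ∀ k → Var k → Maybe (Term Y k)

  Subst : Set
  Subst = Substitution (λ _ → ⊥)

  identity : Subst
  identity _ _ = nothing

  _extends_ : Subst → Subst → Set
  σ extends θ = ∀ {k} {x : Var k} {t} → θ _ x ≡ just t → σ _ x ≡ just t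

  -- dom σ is the set D of variables.
  _hasDomain_ : Subst → (∀ {k} → Var k → Set) → Set
  σ hasDomain D = ∀ {k} (x : Var k) → Is-just (σ _ x) ⇔ D x

  -- Inst R u v: v is u with every variable x replaced by a term R-related to x.
  mutual
    data Inst (R : ∀ {k} → X k → Term Y k → Set) : Term X k → Term Y k → Set where
      var : {x : X k} {t : Term Y k} → R x t → Inst R (var x) t
      op  : {f : Op ks k} {ts : Args X ks} {us : Args Y ks} →
            Insts R ts us → Inst R (op f ts) (op f us)

    data Insts (R : ∀ {k} → X k → Term Y k → Set) : Args X ks → Args Y ks → Set where
      []  : Insts R [] []
      _∷_ : {t : Term X k} {u : Term Y k} {ts : Args X ks} {us : Args Y ks} →
            Inst R t u → Insts R ts us → Insts R (t ∷ ts) (u ∷ us)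

  -- σ ⊢ u ↦ v: all variables of u are bound by σ, and σ(u) = v.
  _⊢_↦_ : Substitution Y → Pattern k → Term Y k → Set
  σ ⊢ u ↦ v = Inst (λ x t → σ _ x ≡ just t) u v

  data Atom : Set where
    _≐_ : Pattern k → Pattern k → Atom
    _∶_ : Pattern k → Sort k → Atom

  Condition : Set
  Condition = List Atom

  data _occursInAtom_ (x : Var k) : Atom → Set where
    left  : {u v : Pattern k′} → x occursIn u → x occursInAtom (u ≐ v)
    right : {u v : Pattern k′} → x occursIn v → x occursInAtom (u ≐ v)
    mem   : {u : Pattern k′} {s : Sort k′} → x occursIn u → x occursInAtom (u ∶ s)

  _occursInCond_ : Var k → Condition → Set
  x occursInCond C = Any (x occursInAtom_) C

record EquationalTheory : Set₁ where
  field
    signature : Signature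
  open Terms signature public
  field
    -- axiom A C: the sentence (∀ vars) A if C belongs to E.
    axiom : Atom → Condition → Set

  private variable
    k  : Kind
    ks : List Kind
    Y  : Family

  infix 4 _≈_ _≈*_

  mutual
    data _≈_ {Y : Family} : Term Y k → Term Y k → Set where
      refl  : {t : Term Y k} → t ≈ t
      sym   : {t u : Term Y k} → t ≈ u → u ≈ t
      trans : {t u v : Term Y k} → t ≈ u → u ≈ v → t ≈ v
      cong  : (f : Op ks k) {ts us : Args Y ks} → ts ≈* us → op f ts ≈ op f us
      ax    : {u v : Pattern k} {C : Condition} {t t′ : Term Y k} (σ : Substitution Y) →
              axiom (u ≐ v) C → All (Holds σ) C → σ ⊢ u ↦ t → σ ⊢ v ↦ t′ → t ≈ t′

    data _≈*_ {Y : Family} : Args Y ks → Args Y ks → Set where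
      []  : [] ≈* []
      _∷_ : {t u : Term Y k} {ts us : Args Y ks} → t ≈ u → ts ≈* us → (t ∷ ts) ≈* (u ∷ us)

    data HasSort {Y : Family} : Term Y k → Sort k → Set where
      resp : {t u : Term Y k} {s : Sort k} → t ≈ u → HasSort t s → HasSort u s
      ax   : {u : Pattern k} {s : Sort k} {C : Condition} {t : Term Y k} (σ : Substitution Y) →
             axiom (u ∶ s) C → All (Holds σ) C → σ ⊢ u ↦ t → HasSort t s

    data Holds {Y : Family} (σ : Substitution Y) : Atom → Set where
      eq  : {u v : Pattern k} {t t′ : Term Y k} →
            σ ⊢ u ↦ t → σ ⊢ v ↦ t′ → t ≈ t′ → Holds σ (u ≐ v)
      mem : {u : Pattern k} {s : Sort k} {t : Term Y k} →
            σ ⊢ u ↦ t → HasSort t s → Holds σ (u ∶ s)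

  Satisfies : Substitution Y → Condition → Set
  Satisfies σ C = All (Holds σ) C

  termSetoid : Family → Kind → Setoid 0ℓ 0ℓ
  termSetoid Y k = record
    { Carrier       = Term Y k
    ; _≈_           = _≈_
    ; isEquivalence = record { refl = refl ; sym = sym ; trans = trans }
    }

  Associative : Op (k ∷ k ∷ []) k → Set
  Associative {k} f = (x y z : Pattern k) →
    op f (x ∷ op f (y ∷ z ∷ []) ∷ []) ≈ op f (op f (x ∷ y ∷ []) ∷ z ∷ [])

  data Positions : Set where
    atRoot withExtension anywhere : Positions

  -- At μ P c: a pattern P may be matched inside the context c.  Matching with
  -- extension reaches any portion of the flattened form of a term whose top
  -- operator is the (associative) top operator of the pattern.
  data At : Positions → {k₀ k : Kind} → Pattern k₀ → Holed k₀ k → Set where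
    root     : ∀ {μ k} {P : Pattern k} → At μ P (var refl)
    extˡ     : {f : Op (k ∷ k ∷ []) k} {ps : Args Var (k ∷ k ∷ [])} (y : Ground k) →
               Associative f →
               At withExtension (op f ps) (op f (var refl ∷ ⌜ y ⌝ ∷ []))
    extʳ     : {f : Op (k ∷ k ∷ []) k} {ps : Args Var (k ∷ k ∷ [])} (x : Ground k) →
               Associative f →
               At withExtension (op f ps) (op f (⌜ x ⌝ ∷ var refl ∷ []))
    extˡʳ    : {f : Op (k ∷ k ∷ []) k} {ps : Args Var (k ∷ k ∷ [])} (x y : Ground k) →
               Associative f →
               At withExtension (op f ps)
                  (op f (⌜ x ⌝ ∷ op f (var refl ∷ ⌜ y ⌝ ∷ []) ∷ []))
    anywhere : ∀ {k₀ k} {P : Pattern k₀} {c : Holed k₀ k} → OneHole c → At anywhere P c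

  -- Rule conditions with m rewriting fragments.  Every list of fragments
  -- splits uniquely as C₀ ∧ l₁ ⇒ p₁ ∧ C₁ ∧ … ∧ l_m ⇒ p_m ∧ C_m with the C_i
  -- equational.
  data RuleCondition : ℕ → Set where
    final    : Condition → RuleCondition 0
    _∧_⇒_∧′_ : ∀ {m} → Condition → Pattern k → Pattern k → RuleCondition m →
               RuleCondition (suc m)

record RewriteTheory : Set₁ where
  field
    equational : EquationalTheory
  open EquationalTheory equational public
  field
    Label : Set
    rule  : ∀ {k m} → Label → Pattern k → Pattern k → RuleCondition m → Set

  private variable
    k k₀ : Kind

  mutual
    -- One-step rewriting modulo E, restricted to the given positions.
    data Rewrite (μ : Positions) : Ground k → Ground k → Set where
      step : ∀ {m rl} {l r : Pattern k₀} {C : RuleCondition m} {c : Holed k₀ k}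
             {t t′ : Ground k} {u v : Ground k₀} (σ : Subst) →
             rule rl l r C → At μ l c →
             σ ⊢ l ↦ u → t ≈ c [ u ] → SatisfiesRC σ C →
             σ ⊢ r ↦ v → c [ v ] ≈ t′ →
             Rewrite μ t t′

    data SatisfiesRC (σ : Subst) : ∀ {m} → RuleCondition m → Set where
      final : ∀ {C} → Satisfies σ C → SatisfiesRC σ (final C)
      frag  : ∀ {m C} {C′ : RuleCondition m} {l p : Pattern k} {u u′ v : Ground k} →
              Satisfies σ C →
              σ ⊢ l ↦ u → Star (Rewrite anywhere) u u′ → u′ ≈ v → σ ⊢ p ↦ v →
              SatisfiesRC σ C′ → SatisfiesRC σ (C ∧ l ⇒ p ∧′ C′)

module Expressions (𝓡 : RewriteTheory) (Name : List (RewriteTheory.Kind 𝓡) → Set) where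
  open RewriteTheory 𝓡

  Variable : Set
  Variable = ∃ Var

  -- x ← t
  Binding : Set
  Binding = Σ[ x ∈ Variable ] Pattern (proj₁ x)

  -- match, xmatch and amatch (and likewise the matchrews) differ in the
  -- positions; the Boolean argument of all and apply tells whether the rule
  -- application is wrapped in top.
  data Strat : Set where
    idle fail   : Strat
    match       : ∀ {k} → Positions → Pattern k → Condition → Strat
    _⨾_ _∣_     : Strat → Strat → Strat
    _⋆          : Strat → Strat
    _¿_∶_       : Strat → Strat → Strat → Strat
    matchrew    : ∀ {k} → Positions → Pattern k → Condition → List (Variable × Strat) → Strat
    call        : ∀ {ks} → Name ks → Args Var ks → Strat
    all         : Bool → Strat
    apply       : ∀ {m} → Bool → Label → List Binding → Vec Strat m → Strat

record StrategyDefinitions (𝓡 : RewriteTheory) : Set₁ where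
  open RewriteTheory 𝓡
  field
    Name : List Kind → Set
  open Expressions 𝓡 Name public
  field
    -- definition sl ps C δ: the set of definitions includes sl(ps) := δ if C.
    definition : ∀ {ks} → Name ks → Args Var ks → Condition → Strat → Set

module States {𝓡 : RewriteTheory} (𝓓 : StrategyDefinitions 𝓡) where
  open RewriteTheory 𝓡
  open StrategyDefinitions 𝓓

  private variable
    k k₀ k₁ : Kind
    m       : ℕ

  data Item : Set where
    strat : Strat → Item
    subst : Subst → Item

  Stack : Set
  Stack = List Item

  vctx : Stack → Subst
  vctx []            = identity
  vctx (strat _ ∷ s) = vctx s
  vctx (subst θ ∷ _) = θ

  -- The variables x₁, …, xₙ, as a family.
  Among : List Variable → Family
  Among xs k = Σ[ x ∈ Var k ] (k , x) ∈ₗ xs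

  -- States are indexed by the kind of their current term, which no transition
  -- changes.
  data XS : Kind → Set where
    _＠_    : Ground k → Stack → XS k
    subterm : (xs : List Variable) (qs : All (λ x → XS (proj₁ x)) xs)
              (t : Term (Among xs) k) (s : Stack) → XS k
    rewc    : (p : Pattern k₁) (q : XS k₁) (σ : Subst) (C : RuleCondition m)
              (αs : Vec Strat m) (θ : Subst) (r : Pattern k₀) (c : Holed k₀ k)
              (t : Ground k) (s : Stack) → XS k

  mutual
    cterm : XS k → Ground k
    cterm (t ＠ s)                        = t
    cterm (subterm xs qs t s)             = bind (λ (_ , x∈xs) → cterms qs x∈xs) t
    cterm (rewc p q σ C αs θ r c t s)     = t

    cterms : ∀ {xs x} → All (λ y → XS (proj₁ y)) xs → x ∈ₗ xs → Ground (proj₁ x)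
    cterms (q ∷ qs) (here refl)  = cterm q
    cterms (q ∷ qs) (there x∈xs) = cterms qs x∈xs

  data Solution : XS k → Set where
    solution : (t : Ground k) → Solution (t ＠ [])

  -- Equality of states: terms, also within substitutions and contexts, are
  -- compared modulo E; program text is compared syntactically.
  _≈ˢ_ : Subst → Subst → Set
  σ ≈ˢ σ′ = ∀ {k} (x : Var k) → Maybe.Pointwise _≈_ (σ _ x) (σ′ _ x)

  data _≈ⁱ_ : Item → Item → Set where
    strat : ∀ {α} → strat α ≈ⁱ strat α
    subst : {θ θ′ : Subst} → θ ≈ˢ θ′ → subst θ ≈ⁱ subst θ′

  _≈ᵏ_ : Stack → Stack → Set
  _≈ᵏ_ = Pointwise _≈ⁱ_

  infix 4 _≋_ _≋*_

  mutual
    data _≋_ : XS k → XS k → Set where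
      _＠_    : {t t′ : Ground k} {s s′ : Stack} → t ≈ t′ → s ≈ᵏ s′ → (t ＠ s) ≋ (t′ ＠ s′)
      subterm : ∀ {xs qs qs′ s s′} {t t′ : Term (Among xs) k} →
                qs ≋* qs′ → t ≈ t′ → s ≈ᵏ s′ → subterm xs qs t s ≋ subterm xs qs′ t′ s′
      rewc    : ∀ {p : Pattern k₁} {q q′ σ σ′} {C : RuleCondition m} {αs} {θ θ′ : Subst}
                {r : Pattern k₀} {c c′} {t t′ : Ground k} {s s′} →
                q ≋ q′ → σ ≈ˢ σ′ → θ ≈ˢ θ′ → c ≈ c′ → t ≈ t′ → s ≈ᵏ s′ →
                rewc p q σ C αs θ r c t s ≋ rewc p q′ σ′ C αs θ′ r c′ t′ s′

    data _≋*_ : ∀ {xs} → All (λ x → XS (proj₁ x)) xs → All (λ x → XS (proj₁ x)) xs → Set where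
      []  : [] ≋* []
      _∷_ : ∀ {x xs} {q q′ : XS (proj₁ {B = Var} x)} {qs qs′ : All _ xs} →
            q ≋ q′ → qs ≋* qs′ → _≋*_ {x ∷ xs} (q ∷ qs) (q′ ∷ qs′)

  positions : Bool → Positions
  positions top = if top then atRoot else anywhere

  -- σ x = θ(t) for every x ← t in ρ.
  Initialises : (θ σ : Subst) → List Binding → Set
  Initialises θ σ ρ = All (λ ((_ , x) , t) → ∃[ u ] θ ⊢ t ↦ u × σ _ x ≡ just u) ρ

  _boundIn_ : Var k → List Binding → Set
  x boundIn ρ = (_ , x) ∈ₗ map proj₁ ρ

  -- σ restricted to the variables outside xs, and leaving those in xs untouched.
  data _∖_∶_↦_ (σ : Subst) (xs : List Variable) (x : Var k) : Term (Among xs) k → Set where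
    keep    : (x∈xs : (k , x) ∈ₗ xs) → σ ∖ xs ∶ x ↦ var (x , x∈xs)
    replace : ∀ {t} → (k , x) ∉ₗ xs → σ _ x ≡ just t → σ ∖ xs ∶ x ↦ ⌜ t ⌝

  -- The states σ(x₁) ＠ α₁σ, …, σ(xₙ) ＠ αₙσ.
  data Subruns (σ : Subst) : (by : List (Variable × Strat)) →
                             All (λ x → XS (proj₁ x)) (map proj₁ by) → Set where
    []  : Subruns σ [] []
    _∷_ : ∀ {k x α by qs} {t : Ground k} → σ _ x ≡ just t → Subruns σ by qs →
          Subruns σ (((k , x) , α) ∷ by) ((t ＠ (strat α ∷ subst σ ∷ [])) ∷ qs)

  data AllSolutions : ∀ {xs} → All (λ x → XS (proj₁ x)) xs → Set where
    []  : AllSolutions []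
    _∷_ : ∀ {x xs} {q : XS (proj₁ {B = Var} x)} {qs : All _ xs} →
          Solution q → AllSolutions qs → AllSolutions {x ∷ xs} (q ∷ qs)

  -- Stack left under the body of a called strategy.
  afterCall : Stack → Stack
  afterCall (subst _ ∷ s) = s
  afterCall s             = s

  ≈ˢ-refl : {σ : Subst} → σ ≈ˢ σ
  ≈ˢ-refl x = Maybe.refl refl
  ≈ˢ-sym : {σ τ : Subst} → σ ≈ˢ τ → τ ≈ˢ σ
  ≈ˢ-sym e x = Maybe.sym sym (e x)
  ≈ˢ-trans : {σ τ υ : Subst} → σ ≈ˢ τ → τ ≈ˢ υ → σ ≈ˢ υ
  ≈ˢ-trans e f x = Maybe.trans trans (e x) (f x)

  ≈ⁱ-refl : ∀ {i} → i ≈ⁱ i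
  ≈ⁱ-refl {strat _} = strat
  ≈ⁱ-refl {subst σ} = subst (≈ˢ-refl {σ})
  ≈ⁱ-sym : ∀ {i j} → i ≈ⁱ j → j ≈ⁱ i
  ≈ⁱ-sym strat = strat
  ≈ⁱ-sym (subst {σ} {τ} e) = subst (≈ˢ-sym {σ} {τ} e)
  ≈ⁱ-trans : ∀ {i j l} → i ≈ⁱ j → j ≈ⁱ l → i ≈ⁱ l
  ≈ⁱ-trans strat strat = strat
  ≈ⁱ-trans (subst {σ} {τ} e) (subst {_} {υ} f) = subst (≈ˢ-trans {σ} {τ} {υ} e f)

  ≈ᵏ-refl : ∀ {S} → S ≈ᵏ S
  ≈ᵏ-refl = Pointwise.refl ≈ⁱ-refl
  ≈ᵏ-sym : ∀ {S T} → S ≈ᵏ T → T ≈ᵏ S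
  ≈ᵏ-sym = Pointwise.symmetric ≈ⁱ-sym
  ≈ᵏ-trans : ∀ {S T U} → S ≈ᵏ T → T ≈ᵏ U → S ≈ᵏ U
  ≈ᵏ-trans = Pointwise.transitive ≈ⁱ-trans

  mutual
    ≋-refl : {q : XS k} → q ≋ q
    ≋-refl {q = t ＠ S} = refl ＠ ≈ᵏ-refl
    ≋-refl {q = subterm xs qs t S} = subterm ≋*-refl refl ≈ᵏ-refl
    ≋-refl {q = rewc p q σ C αs θ r c t S} =
      rewc ≋-refl (≈ˢ-refl {σ}) (≈ˢ-refl {θ}) refl refl ≈ᵏ-refl
    ≋*-refl : ∀ {xs} {qs : All (λ x → XS (proj₁ x)) xs} → qs ≋* qs
    ≋*-refl {qs = []} = []
    ≋*-refl {qs = q ∷ qs} = ≋-refl ∷ ≋*-refl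

  mutual
    ≋-sym : {q q′ : XS k} → q ≋ q′ → q′ ≋ q
    ≋-sym (t ＠ S) = sym t ＠ ≈ᵏ-sym S
    ≋-sym (subterm qs t S) = subterm (≋*-sym qs) (sym t) (≈ᵏ-sym S)
    ≋-sym (rewc {σ = σ} {σ′} {θ = θ} {θ′} q a b c t S) =
      rewc (≋-sym q) (≈ˢ-sym {σ} {σ′} a) (≈ˢ-sym {θ} {θ′} b) (sym c) (sym t) (≈ᵏ-sym S)
    ≋*-sym : ∀ {xs} {qs qs′ : All (λ x → XS (proj₁ x)) xs} → qs ≋* qs′ → qs′ ≋* qs
    ≋*-sym [] = []
    ≋*-sym (q ∷ qs) = ≋-sym q ∷ ≋*-sym qs

  mutual
    ≋-trans : {q q′ q″ : XS k} → q ≋ q′ → q′ ≋ q″ → q ≋ q″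
    ≋-trans (t ＠ S) (t′ ＠ S′) = trans t t′ ＠ ≈ᵏ-trans S S′
    ≋-trans (subterm qs t S) (subterm qs′ t′ S′) =
      subterm (≋*-trans qs qs′) (trans t t′) (≈ᵏ-trans S S′)
    ≋-trans (rewc {σ = σ} {σ′} {θ = θ} {θ′} q a b c t S)
            (rewc {σ′ = σ″} {θ′ = θ″} q′ a′ b′ c′ t′ S′) =
      rewc (≋-trans q q′) (≈ˢ-trans {σ} {σ′} {σ″} a a′) (≈ˢ-trans {θ} {θ′} {θ″} b b′)
           (trans c c′) (trans t t′) (≈ᵏ-trans S S′)
    ≋*-trans : ∀ {xs} {qs qs′ qs″ : All (λ x → XS (proj₁ x)) xs} →
               qs ≋* qs′ → qs′ ≋* qs″ → qs ≋* qs″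
    ≋*-trans [] [] = []
    ≋*-trans (q ∷ qs) (q′ ∷ qs′) = ≋-trans q q′ ∷ ≋*-trans qs qs′

  Solution-≋ : {q q′ : XS k} → q ≋ q′ → Solution q → Solution q′
  Solution-≋ (e ＠ []) (solution t) = solution _

  data Tag : Set where
    control system : Tag

  -- The transition rules, where the premise of the negative branch of a
  -- conditional is Fails.
  data Step (Fails : ∀ {k} → XS k → Set) : Tag → XS k → XS k → Set where

    -- States are taken modulo ≋.
    resp : ∀ {τ} {q q₁ q₂ q′ : XS k} →
           q ≋ q₁ → Step Fails τ q₁ q₂ → q₂ ≋ q′ → Step Fails τ q q′

    idle : ∀ {t : Ground k} {S} → Step Fails control (t ＠ (strat idle ∷ S)) (t ＠ S)
    pop  : ∀ {t : Ground k} {θ : Subst} {S} → Step Fails control (t ＠ (subst θ ∷ S)) (t ＠ S)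

    match : ∀ {t : Ground k} {S μ} {P : Pattern k₀} {C} {d : Holed k₀ k} {u} (σ : Subst) →
            σ extends vctx S → At μ P d → σ ⊢ P ↦ u → t ≈ d [ u ] → Satisfies σ C →
            Step Fails control (t ＠ (strat (match μ P C) ∷ S)) (t ＠ S)

    seq  : ∀ {t : Ground k} {α β S} →
           Step Fails control (t ＠ (strat (α ⨾ β) ∷ S)) (t ＠ (strat α ∷ strat β ∷ S))
    altˡ : ∀ {t : Ground k} {α β S} →
           Step Fails control (t ＠ (strat (α ∣ β) ∷ S)) (t ＠ (strat α ∷ S))
    altʳ : ∀ {t : Ground k} {α β S} →
           Step Fails control (t ＠ (strat (α ∣ β) ∷ S)) (t ＠ (strat β ∷ S))
    exit : ∀ {t : Ground k} {α S} →
           Step Fails control (t ＠ (strat (α ⋆) ∷ S)) (t ＠ S)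
    loop : ∀ {t : Ground k} {α S} →
           Step Fails control (t ＠ (strat (α ⋆) ∷ S)) (t ＠ (strat α ∷ strat (α ⋆) ∷ S))

    then : ∀ {t : Ground k} {α β γ S} →
           Step Fails control (t ＠ (strat (α ¿ β ∶ γ) ∷ S)) (t ＠ (strat α ∷ strat β ∷ S))
    else : ∀ {t : Ground k} {α β γ S} →
           Fails (t ＠ (strat α ∷ subst (vctx S) ∷ [])) →
           Step Fails control (t ＠ (strat (α ¿ β ∶ γ) ∷ S)) (t ＠ (strat γ ∷ S))

    all : ∀ {t t′ : Ground k} {top S} → Rewrite (positions top) t t′ →
          Step Fails system (t ＠ (strat (all top) ∷ S)) (t′ ＠ S)

    apply : ∀ {t : Ground k} {S top rl ρ} {l r : Pattern k₀} {C} {d : Holed k₀ k} {u v}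
           (σ : Subst) →
           rule rl l r (final C) → Initialises (vctx S) σ ρ →
           At (positions top) l d → σ ⊢ l ↦ u → t ≈ d [ u ] → Satisfies σ C → σ ⊢ r ↦ v →
           Step Fails system (t ＠ (strat (apply top rl ρ []) ∷ S)) ((d [ v ]) ＠ S)

    -- Besides the left-hand side and C₀, σ has to bind l₁, which it instantiates.
    rewc-start : ∀ {t : Ground k} {S top rl ρ α} {αs : Vec Strat m} {l r : Pattern k₀}
                 {C₀} {l₁ p₁ : Pattern k₁} {C′} {d : Holed k₀ k} {u u₁} (σ : Subst) →
                 rule rl l r (C₀ ∧ l₁ ⇒ p₁ ∧′ C′) → Initialises (vctx S) σ ρ →
                 σ hasDomain (λ x → x boundIn ρ ⊎ x occursIn l ⊎ x occursInCond C₀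
                                                ⊎ x occursIn l₁) →
                 At (positions top) l d → σ ⊢ l ↦ u → t ≈ d [ u ] → Satisfies σ C₀ →
                 σ ⊢ l₁ ↦ u₁ →
                 Step Fails control (t ＠ (strat (apply top rl ρ (α ∷ αs)) ∷ S))
                   (rewc p₁ (u₁ ＠ (strat α ∷ subst (vctx S) ∷ [])) σ C′ αs (vctx S) r d t S)

    rewc-step : ∀ {τ} {p : Pattern k₁} {q q′ σ} {C : RuleCondition m} {αs} {θ : Subst}
                {r : Pattern k₀} {d} {t : Ground k} {S} →
                Step Fails τ q q′ →
                Step Fails control (rewc p q σ C αs θ r d t S) (rewc p q′ σ C αs θ r d t S)

    rewc-next : ∀ {p : Pattern k₁} {t′ σ C₀} {k₂} {l p′ : Pattern k₂} {C : RuleCondition m}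
                {α αs} {θ : Subst} {r : Pattern k₀} {d} {t : Ground k} {S u u′} (σ′ : Subst) →
                σ′ extends σ →
                σ′ hasDomain (λ x → Is-just (σ _ x) ⊎ x occursIn p ⊎ x occursInCond C₀
                                                  ⊎ x occursIn l) →
                σ′ ⊢ p ↦ u → u ≈ t′ → Satisfies σ′ C₀ → σ′ ⊢ l ↦ u′ →
                Step Fails control
                  (rewc p (t′ ＠ []) σ (C₀ ∧ l ⇒ p′ ∧′ C) (α ∷ αs) θ r d t S)
                  (rewc p′ (u′ ＠ (strat α ∷ subst θ ∷ [])) σ′ C αs θ r d t S)

    rewc-end : ∀ {p : Pattern k₁} {t′ σ C₀} {θ : Subst} {r : Pattern k₀} {d}
               {t : Ground k} {S u v} (σ′ : Subst) →
               σ′ extends σ → σ′ ⊢ p ↦ u → u ≈ t′ → Satisfies σ′ C₀ → σ′ ⊢ r ↦ v →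
               Step Fails system (rewc p (t′ ＠ []) σ (final C₀) [] θ r d t S) ((d [ v ]) ＠ S)

    matchrew : ∀ {t : Ground k} {S μ} {P : Pattern k₀} {C by} {d : Holed k₀ k} {u v qs}
               (σ : Subst) →
               σ extends vctx S →
               σ hasDomain (λ x → Is-just (vctx S _ x) ⊎ x occursIn P ⊎ x occursInCond C) →
               At μ P d → σ ⊢ P ↦ u → t ≈ d [ u ] → Satisfies σ C →
               Subruns σ by qs → Inst (σ ∖ map proj₁ by ∶_↦_) P v →
               Step Fails control (t ＠ (strat (matchrew μ P C by) ∷ S))
                            (subterm (map proj₁ by) qs (d [ v ]) S)

    subterm-step : ∀ {τ x xs qs S} {q′ : XS (proj₁ x)} {t : Term (Among xs) k}
                   (x∈xs : x ∈ₗ xs) →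
                   Step Fails τ (All.lookup qs x∈xs) q′ →
                   Step Fails τ (subterm xs qs t S) (subterm xs (qs [ x∈xs ]≔ q′) t S)

    subterm-end : ∀ {xs qs S} {t : Term (Among xs) k} →
                  AllSolutions qs →
                  Step Fails control (subterm xs qs t S) (cterm (subterm xs qs t S) ＠ S)

    call : ∀ {t : Ground k} {S ks} {sl : Name ks} {ts ps : Args Var ks} {C δ us vs} (σ : Subst) →
           definition sl ps C δ →
           Insts (λ x u → vctx S _ x ≡ just u) ts us →
           σ hasDomain (λ x → x occursInArgs ps ⊎ x occursInCond C) →
           Insts (λ x v → σ _ x ≡ just v) ps vs → vs ≈* us → Satisfies σ C →
           Step Fails control (t ＠ (strat (call sl ts) ∷ S)) (t ＠ (strat δ ∷ subst σ ∷ afterCall S))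

  module Transitions (Fails : ∀ {k} → XS k → Set) where

    infix 4 _→c_ _→s_ _→sc_ _↠_

    _→c_ _→s_ _→sc_ _↠_ : XS k → XS k → Set
    _→c_      = Step Fails control
    _→s_      = Step Fails system
    q →sc q′  = q →s q′ ⊎ q →c q′
    q ↠ q′    = ∃[ q₁ ] Star _→c_ q q₁ × q₁ →s q′

    TerminatingFrom : XS k → Set
    TerminatingFrom = Acc (flip _→sc_)

    ReachesSolution : XS k → Set
    ReachesSolution q = ∃[ q′ ] Star _→sc_ q q′ × Solution q′

-- The transition relation is defined in terms of itself through the premise of
-- the negative branch of conditionals: it is the relation that the rules
-- generate from a predicate meaning, for that very relation, termination
-- without solutions.
record Semantics {𝓡 : RewriteTheory} (𝓓 : StrategyDefinitions 𝓡) : Set₁ where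
  open RewriteTheory 𝓡
  open StrategyDefinitions 𝓓 public
  open States 𝓓 public
  field
    Fails   : ∀ {k} → XS k → Set
    fails-⇔ : let open Transitions Fails in
              ∀ {k} (q : XS k) → Fails q ⇔ (TerminatingFrom q × ¬ ReachesSolution q)
  open Transitions Fails public

  private variable
    k : Kind

  start : Strat → Ground k → XS k
  start α t = t ＠ (strat α ∷ [])

  -- Finite q qs: qs is a sequence q₀ ⋯ qₙ with q₀ = q and q_i ↠ q_{i+1} such
  -- that qₙ reaches a solution by control transitions.
  data Finite : XS k → List (XS k) → Set where
    stop : {q q′ : XS k} → Star _→c_ q q′ → Solution q′ → Finite q (q ∷ [])
    step : ∀ {q q′ : XS k} {qs} → q ↠ q′ → Finite q′ qs → Finite q (q ∷ qs)

  Ex* : Strat → Ground k → List (XS k) → Set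
  Ex* α t qs = Finite (start α t) qs

  Exω : Strat → Ground k → (ℕ → XS k) → Set
  Exω α t qs = qs 0 ≡ start α t × (∀ i → qs i ↠ qs (suc i))

  open module Words′ {k} = Words (termSetoid (λ _ → ⊥) k) public
  open module Regularity′ {k} = Regularity (termSetoid (λ _ → ⊥) k) public

  E : Strat → Ground k → Language
  E α t = record
    { finite   = λ w → ∃[ qs ] Ex* α t qs × Pointwise _≈_ w (map cterm qs)
    ; infinite = λ w → ∃[ qs ] Exω α t qs × (∀ i → w i ≈ cterm (qs i))
    }

  FinitelyManyReachable : XS k → Set
  FinitelyManyReachable {k} q =
    Σ[ qs ∈ List (XS k) ] (∀ {q′} → Star _→sc_ q q′ → Any (q′ ≋_) qs)

-- The circularity in Semantics is harmless: for every set of definitions there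
-- is exactly one predicate Fails of the required kind.  Whenever the negative
-- branch of α ¿ β ∶ γ is considered, so is the positive one, whose execution
-- contains a copy of that of α; hence below a terminating state termination of
-- α never depends on itself.
module WellDefined {𝓡 : RewriteTheory} (𝓓 : StrategyDefinitions 𝓡) where
  open RewriteTheory 𝓡
  open StrategyDefinitions 𝓓
  open States 𝓓

  private variable
    k k₀ k₁ k₂ : Kind

  Pred : Set₁
  Pred = ∀ {k} → XS k → Set

  None : Pred
  None _ = ⊥

  data Like {k} (o : XS k) : ∀ {k′} → XS k′ → Set where
    like : ∀ {q} → q ≋ o → Like o q

  mono : ∀ {F G : Pred} → (∀ {k} {q : XS k} → F q → G q) →
         ∀ {τ} {q q′ : XS k} → Step F τ q q′ → Step G τ q q′
  mono f (resp a x b) = resp a (mono f x) b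
  mono f idle = idle
  mono f pop = pop
  mono f (match σ a b c d e) = match σ a b c d e
  mono f seq = seq
  mono f altˡ = altˡ
  mono f altʳ = altʳ
  mono f exit = exit
  mono f loop = loop
  mono f then = then
  mono f (else x) = else (f x)
  mono f (all x) = all x
  mono f (apply σ a b c d e g h) = apply σ a b c d e g h
  mono f (rewc-start σ a b c d e g h i) = rewc-start σ a b c d e g h i
  mono f (rewc-step x) = rewc-step (mono f x)
  mono f (rewc-next σ a b c d e g) = rewc-next σ a b c d e g
  mono f (rewc-end σ a b c d e) = rewc-end σ a b c d e
  mono f (matchrew σ a b c d e g h i) = matchrew σ a b c d e g h i
  mono f (subterm-step i x) = subterm-step i (mono f x)
  mono f (subterm-end x) = subterm-end x
  mono f (call σ a b c d e g) = call σ a b c d e g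

  none-any : ∀ {F : Pred} {τ} {q q′ : XS k} → Step None τ q q′ → Step F τ q q′
  none-any {F = F} = mono {F = None} {G = F} ⊥-elim

  -- A step rests on at most one instance of the premise of the negative branch.
  Split : (F : Pred) → Tag → XS k → XS k → Set
  Split F τ q q′ = Step None τ q q′ ⊎ Σ Kind λ k′ → Σ (XS k′) λ o → F o × Step (Like o) τ q q′

  liftS : ∀ {F : Pred} {τ τ′} {q q′ : XS k} {p p′ : XS k₁} →
          (∀ {G : Pred} → Step G τ q q′ → Step G τ′ p p′) → Split F τ q q′ → Split F τ′ p p′
  liftS f (inj₁ x) = inj₁ (f {None} x)
  liftS f (inj₂ (_ , o , a , x)) = inj₂ (_ , o , a , f {Like o} x)

  split : ∀ {F : Pred} {τ} {q q′ : XS k} → Step F τ q q′ → Split F τ q q′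
  split {F = F} (resp a x b) = liftS {F = F} (λ {G} y → resp {Fails = G} a y b) (split x)
  split idle = inj₁ idle
  split pop = inj₁ pop
  split (match σ a b c d e) = inj₁ (match σ a b c d e)
  split seq = inj₁ seq
  split altˡ = inj₁ altˡ
  split altʳ = inj₁ altʳ
  split exit = inj₁ exit
  split loop = inj₁ loop
  split then = inj₁ then
  split (else x) = inj₂ (_ , _ , x , else (like ≋-refl))
  split (all x) = inj₁ (all x)
  split (apply σ a b c d e g h) = inj₁ (apply σ a b c d e g h)
  split (rewc-start σ a b c d e g h i) = inj₁ (rewc-start σ a b c d e g h i)
  split {F = F} (rewc-step x) = liftS {F = F} (λ {G} → rewc-step {Fails = G}) (split x)
  split (rewc-next σ a b c d e g) = inj₁ (rewc-next σ a b c d e g)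
  split (rewc-end σ a b c d e) = inj₁ (rewc-end σ a b c d e)
  split (matchrew σ a b c d e g h i) = inj₁ (matchrew σ a b c d e g h i)
  split {F = F} (subterm-step i x) = liftS {F = F} (λ {G} → subterm-step {Fails = G} i) (split x)
  split (subterm-end x) = inj₁ (subterm-end x)
  split (call σ a b c d e g) = inj₁ (call σ a b c d e g)

  -- Failure trees.  A step resting on the failure of o need not be followed if
  -- o succeeds.
  mutual
    data Failing {k} (q : XS k) : Set where
      mk : ¬ Solution q →
           (∀ {τ q′} → Step None τ q q′ → Failing q′) →
           (∀ {τ q′ k′} {o : XS k′} → Step (Like o) τ q q′ → Succeeding o ⊎ Failing q′) →
           Failing q

    data Succeeding {k} (q : XS k) : Set where
      done : Solution q → Succeeding q
      now  : ∀ {τ q′} → Step None τ q q′ → Succeeding q′ → Succeeding q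
      cond : ∀ {τ q′ k′} {o : XS k′} → Failing o → Step (Like o) τ q q′ → Succeeding q′ →
             Succeeding q

  disjoint : {q : XS k} → Failing q → Succeeding q → ⊥
  disjoint (mk a b c) (done s) = a s
  disjoint (mk a b c) (now x s) = disjoint (b x) s
  disjoint (mk a b c) (cond f x s) with c x
  ... | inj₁ so = disjoint f so
  ... | inj₂ fq = disjoint fq s

  Failing-≋ : {q q′ : XS k} → q ≋ q′ → Failing q → Failing q′
  Failing-≋ e (mk a b c) = mk (a ∘ Solution-≋ (≋-sym e))
    (λ x → b (resp e x ≋-refl)) (λ x → c (resp e x ≋-refl))

  Like⇒Failing : {o : XS k} → Failing o → {q : XS k₁} → Like o q → Failing q
  Like⇒Failing f (like e) = Failing-≋ (≋-sym e) f

  _≗ˢ_ : Subst → Subst → Set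
  σ ≗ˢ τ = ∀ {k} (x : Var k) → σ _ x ≡ τ _ x

  -- Tail S T: in executions of t ＠ T, those of t ＠ S occur as initial parts.
  data Tail : Stack → Stack → Set where
    bot : ∀ {θ β S} → θ ≗ˢ vctx S → Tail (subst θ ∷ []) (strat β ∷ S)
    own : ∀ {θ S} → Tail (subst θ ∷ []) (subst θ ∷ S)
    _∷_ : ∀ i {S T} → Tail S T → Tail (i ∷ S) (i ∷ T)

  vctx-≗ : ∀ {S T} → Tail S T → vctx S ≗ˢ vctx T
  vctx-≗ (bot e) = e
  vctx-≗ own x = refl
  vctx-≗ (strat _ ∷ T) = vctx-≗ T
  vctx-≗ (subst _ ∷ T) x = refl

  ≗⇒≈ : {σ τ : Subst} → σ ≗ˢ τ → σ ≈ˢ τ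
  ≗⇒≈ {σ} e x = ≡.subst (Maybe.Pointwise _≈_ (σ _ x)) (e x) (Maybe.refl refl)

  nothing-≈ : ∀ {m} → Maybe.Pointwise (_≈_ {Y = λ _ → ⊥} {k}) m nothing → m ≡ nothing
  nothing-≈ Maybe.nothing = refl

  setctx : ∀ S {θ : Subst} → vctx S ≈ˢ θ → ∃ λ S′ → S ≈ᵏ S′ × (θ ≗ˢ vctx S′)
  setctx [] {θ} e = [] , [] , λ x → nothing-≈ (≈ˢ-sym {identity} {θ} e x)
  setctx (strat α ∷ S) {θ} e with setctx S {θ} e
  ... | S′ , a , b = _ , strat ∷ a , b
  setctx (subst σ ∷ S) {θ} e = subst θ ∷ S , subst e ∷ ≈ᵏ-refl , λ x → refl

  Tail-≈ : ∀ {S S′ T} → Tail S T → S ≈ᵏ S′ → ∃ λ T′ → T ≈ᵏ T′ × Tail S′ T′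
  Tail-≈ (bot {θ} {β} {S} e) (subst {_} {θ′} x ∷ [])
    with setctx S {θ′} (λ y → ≡.subst (λ z → Maybe.Pointwise _≈_ z (θ′ _ y)) (e y) (x y))
  ... | S′ , a , b = strat β ∷ S′ , strat ∷ a , bot b
  Tail-≈ (own {θ} {S}) (subst {_} {θ′} x ∷ []) = subst θ′ ∷ S , subst x ∷ ≈ᵏ-refl , own
  Tail-≈ (i ∷ t) (x ∷ xs) with Tail-≈ t xs
  ... | T′ , a , b = _ , x ∷ a , _ ∷ b

  data StkRel : XS k → XS k → Set where
    _＠_ : ∀ (t : Ground k) {S T} → Tail S T → StkRel (t ＠ S) (t ＠ T)
    subterm : ∀ {xs qs S T} {t : Term (Among xs) k} → Tail S T →
              StkRel (subterm xs qs t S) (subterm xs qs t T)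
    rewc : ∀ {m} {p : Pattern k₁} {q σ} {C : RuleCondition m} {αs} {θ : Subst}
           {r : Pattern k₀} {d : Holed k₀ k} {t S T} → Tail S T →
           StkRel (rewc p q σ C αs θ r d t S) (rewc p q σ C αs θ r d t T)

  StkRel-≋ : {q q₁ p : XS k} → StkRel q p → q ≋ q₁ → ∃ λ p₁ → p ≋ p₁ × StkRel q₁ p₁
  StkRel-≋ (t ＠ T) (e ＠ es) with Tail-≈ T es
  ... | _ , a , b = _ , e ＠ a , _ ＠ b
  StkRel-≋ (subterm T) (subterm qs t es) with Tail-≈ T es
  ... | _ , a , b = _ , subterm qs t a , subterm b
  StkRel-≋ (rewc T) (rewc {σ = σ} {σ′} {θ = θ} {θ′} q x y d t es) with Tail-≈ T es
  ... | _ , a , b = _ , rewc {σ = σ} {σ′} {θ = θ} {θ′} q x y d t a , rewc b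

  -- Every execution from the first state is mirrored by one from the second,
  -- until the first one reaches a solution.
  data Sim : XS k → XS k₁ → Set where
    eqv   : {q p : XS k} → q ≋ p → Sim q p
    stk   : {q p : XS k} → StkRel q p → Sim q p
    sub   : ∀ {x xs qs S} {t : Term (Among xs) k} (i : x ∈ₗ xs) →
            Sim (All.lookup qs i) (subterm xs qs t S)
    rew   : ∀ {m} {p : Pattern k₁} {q σ} {C : RuleCondition m} {αs} {θ : Subst}
            {r : Pattern k₀} {d : Holed k₀ k} {t S} → Sim q (rewc p q σ C αs θ r d t S)
    trans : {q : XS k} {p : XS k₁} {u : XS k₂} → Sim q p → Sim p u → Sim q u

  Insts-map : ∀ {Y} {R Q : ∀ {k} → Var k → Term Y k → Set} →
              (∀ {k} {x : Var k} {t} → R x t → Q x t) →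
              ∀ {ks} {ts : Args Var ks} {us : Args Y ks} → Insts R ts us → Insts Q ts us
  Inst-map : ∀ {Y} {R Q : ∀ {k} → Var k → Term Y k → Set} →
              (∀ {k} {x : Var k} {t} → R x t → Q x t) →
              ∀ {t : Pattern k} {u : Term Y k} → Inst R t u → Inst Q t u
  Insts-map f [] = []
  Insts-map f (x ∷ xs) = Inst-map f x ∷ Insts-map f xs
  Inst-map f (var x) = var (f x)
  Inst-map f (op x) = op (Insts-map f x)

  ext-≗ : {θ θ′ σ : Subst} → θ ≗ˢ θ′ → σ extends θ → σ extends θ′
  ext-≗ e f y = f (≡.trans (e _) y)

  init-≗ : {θ θ′ σ : Subst} → θ ≗ˢ θ′ → ∀ {ρ} → Initialises θ σ ρ → Initialises θ′ σ ρ
  init-≗ e = All.map λ { (u , a , b) → u , Inst-map (≡.trans (≡.sym (e _))) a , b }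

  Closed≋ : Pred → Set
  Closed≋ F = ∀ {k} {q q′ : XS k} → q ≋ q′ → F q → F q′

  simS : ∀ {F : Pred} → Closed≋ F → ∀ {τ} {q q′ p : XS k} →
         StkRel q p → Step F τ q q′ → ¬ Solution q′ →
         ∃ λ p′ → Step F τ p p′ × Sim q′ p′
  simS cl R (resp a x b) n with StkRel-≋ R a
  ... | p₁ , e , R′ with simS cl R′ x (n ∘ Solution-≋ b)
  ... | p′ , y , s = p′ , resp e y ≋-refl , trans (eqv (≋-sym b)) s
  simS cl (t ＠ (_ ∷ T)) idle n = _ , idle , stk (t ＠ T)
  simS cl (t ＠ bot _) pop n = ⊥-elim (n (solution t))
  simS cl (t ＠ own) pop n = ⊥-elim (n (solution t))
  simS cl (t ＠ (_ ∷ T)) pop n = _ , pop , stk (t ＠ T)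
  simS cl (t ＠ (_ ∷ T)) (match {S = S} σ a b c d e) n =
    _ , match σ (ext-≗ {vctx S} {_} {σ} (vctx-≗ T) a) b c d e , stk (t ＠ T)
  simS cl (t ＠ (_ ∷ T)) seq n = _ , seq , stk (t ＠ (_ ∷ (_ ∷ T)))
  simS cl (t ＠ (_ ∷ T)) altˡ n = _ , altˡ , stk (t ＠ (_ ∷ T))
  simS cl (t ＠ (_ ∷ T)) altʳ n = _ , altʳ , stk (t ＠ (_ ∷ T))
  simS cl (t ＠ (_ ∷ T)) exit n = _ , exit , stk (t ＠ T)
  simS cl (t ＠ (_ ∷ T)) loop n = _ , loop , stk (t ＠ (_ ∷ (_ ∷ T)))
  simS cl (t ＠ (_ ∷ T)) then n = _ , then , stk (t ＠ (_ ∷ (_ ∷ T)))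
  simS cl (t ＠ (_∷_ _ {S} {S′} T)) (else x) n =
    _ , else (cl (refl ＠ (strat ∷ subst (≗⇒≈ {vctx S} {vctx S′} (vctx-≗ T)) ∷ [])) x) , stk (t ＠ (_ ∷ T))
  simS cl (t ＠ (_ ∷ T)) (all x) n = _ , all x , stk (_ ＠ T)
  simS cl (t ＠ (_∷_ _ {S} {S′} T)) (apply σ a b c d e g h) n =
    _ , apply σ a (init-≗ {vctx S} {vctx S′} {σ} (vctx-≗ T) b) c d e g h , stk (_ ＠ T)
  simS cl (t ＠ (_∷_ _ {S} {S′} T)) (rewc-start σ a b c d e g h i) n =
    _ , rewc-start σ a (init-≗ {vctx S} {vctx S′} {σ} (vctx-≗ T) b) c d e g h i ,
    trans (stk (rewc T))
     (eqv (rewc (refl ＠ (strat ∷ subst v ∷ [])) (≈ˢ-refl {σ}) v refl refl ≈ᵏ-refl))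
    where
    v : vctx S ≈ˢ vctx S′
    v = ≗⇒≈ {vctx S} {vctx S′} (vctx-≗ T)
  simS cl (rewc T) (rewc-step x) n = _ , rewc-step x , stk (rewc T)
  simS cl (rewc T) (rewc-next σ a b c d e g) n = _ , rewc-next σ a b c d e g , stk (rewc T)
  simS cl (rewc T) (rewc-end σ a b c d e) n = _ , rewc-end σ a b c d e , stk (_ ＠ T)
  simS cl (t ＠ (_∷_ _ {S} {S′} T)) (matchrew {P = P} {C} σ a b c d e g h i) n =
    _ , matchrew σ (ext-≗ {vctx S} {vctx S′} {σ} (vctx-≗ T) a) dom c d e g h i , stk (subterm T)
    where
    dom : σ hasDomain (λ x → Is-just (vctx S′ _ x) ⊎ x occursIn P ⊎ x occursInCond C)
    dom x = ≡.subst (λ z → Is-just (σ _ x) ⇔ (Is-just z ⊎ x occursIn P ⊎ x occursInCond C))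
                    (vctx-≗ T x) (b x)
  simS cl (subterm T) (subterm-step i x) n = _ , subterm-step i x , stk (subterm T)
  simS cl (subterm T) (subterm-end x) n = _ , subterm-end x , stk (_ ＠ T)
  simS cl (t ＠ (_∷_ _ {S} {S′} T)) (call {δ = δ} σ a b c d e g) n =
    _ , call σ a (Insts-map (λ {k} {x} → ≡.trans (≡.sym (vctx-≗ T x))) b) c d e g ,
    stk (t ＠ (strat δ ∷ after T))
    where
    after : ∀ {S T} → Tail S T → Tail (subst σ ∷ afterCall S) (subst σ ∷ afterCall T)
    after (bot x) = own
    after own = own
    after (strat x ∷ T) = subst σ ∷ (strat x ∷ T)
    after (subst x ∷ T) = subst σ ∷ T

  lookup-≔ : ∀ {x xs} (qs : All (λ y → XS (proj₁ {B = Var} y)) xs) (i : x ∈ₗ xs) {q} →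
             All.lookup (qs [ i ]≔ q) i ≡ q
  lookup-≔ (q ∷ qs) (here refl) = refl
  lookup-≔ (q ∷ qs) (there i) = lookup-≔ qs i

  inSub : ∀ {x xs} {qs : All (λ y → XS (proj₁ {B = Var} y)) xs} {S} {t : Term (Among xs) k} (i : x ∈ₗ xs) {q} →
          Sim q (subterm xs (qs [ i ]≔ q) t S)
  inSub {xs = xs} {qs} {S} {t} i {q} =
    ≡.subst (λ z → Sim z (subterm xs (qs [ i ]≔ q) t S)) (lookup-≔ qs i) (sub i)

  simulate : ∀ {F : Pred} → Closed≋ F → ∀ {τ} {q q′ : XS k} {p : XS k₁} →
             Sim q p → Step F τ q q′ → ¬ Solution q′ →
             ∃₂ λ τ′ p′ → Step F τ′ p p′ × Sim q′ p′
  simulate cl (eqv e) x n = _ , _ , resp (≋-sym e) x ≋-refl , eqv ≋-refl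
  simulate cl (stk R) x n = _ , simS cl R x n
  simulate cl (sub i) x n = _ , _ , subterm-step i x , inSub i
  simulate cl rew x n = _ , _ , rewc-step x , rew
  simulate cl (trans s s′) x n with simulate cl s x n
  ... | τ , p′ , y , r with simulate cl s′ y (nosol r n)
    where
    nosol : ∀ {k k₁} {q : XS k} {p : XS k₁} → Sim q p → ¬ Solution q → ¬ Solution p
    nosol (eqv e) n s = n (Solution-≋ (≋-sym e) s)
    nosol (stk (t ＠ ())) n (solution t)
    nosol (trans a b) n s = nosol b (nosol a n) s
  ... | τ′ , p″ , z , r′ = τ′ , p″ , z , trans r r′

  extract : ∀ {τ} {q q′ : XS k} {o : XS k₁} → Step (Like o) τ q q′ →
            Step None τ q q′ ⊎ ∃₂ λ τ′ p → Step None τ′ q p × Sim o p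
  extract (resp a x b) with extract x
  ... | inj₁ y = inj₁ (resp a y b)
  ... | inj₂ (τ′ , p , y , s) = inj₂ (τ′ , p , resp a y ≋-refl , s)
  extract idle = inj₁ idle
  extract pop = inj₁ pop
  extract (match σ a b c d e) = inj₁ (match σ a b c d e)
  extract seq = inj₁ seq
  extract altˡ = inj₁ altˡ
  extract altʳ = inj₁ altʳ
  extract exit = inj₁ exit
  extract loop = inj₁ loop
  extract then = inj₁ then
  extract (else (like e)) =
    inj₂ (_ , _ , then , trans (eqv (≋-sym e)) (stk (_ ＠ (_ ∷ bot λ _ → refl))))
  extract (all x) = inj₁ (all x)
  extract (apply σ a b c d e g h) = inj₁ (apply σ a b c d e g h)
  extract (rewc-start σ a b c d e g h i) = inj₁ (rewc-start σ a b c d e g h i)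
  extract (rewc-step x) with extract x
  ... | inj₁ y = inj₁ (rewc-step y)
  ... | inj₂ (τ′ , p , y , s) = inj₂ (_ , _ , rewc-step y , trans s rew)
  extract (rewc-next σ a b c d e g) = inj₁ (rewc-next σ a b c d e g)
  extract (rewc-end σ a b c d e) = inj₁ (rewc-end σ a b c d e)
  extract (matchrew σ a b c d e g h i) = inj₁ (matchrew σ a b c d e g h i)
  extract (subterm-step i x) with extract x
  ... | inj₁ y = inj₁ (subterm-step i y)
  ... | inj₂ (τ′ , p , y , s) = inj₂ (_ , _ , subterm-step i y , trans s (inSub i))
  extract (subterm-end x) = inj₁ (subterm-end x)
  extract (call σ a b c d e g) = inj₁ (call σ a b c d e g)

  successor : ∀ {τ} {q q′ : XS k} → Failing q → Step Failing τ q q′ → Failing q′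
  successor (mk a b d) x with split {F = Failing} x
  ... | inj₁ y = b y
  ... | inj₂ (_ , _ , f , y) with d y
  ... | inj₁ s = ⊥-elim (disjoint f s)
  ... | inj₂ g = g

  module Trees (F : Pred) where
    open Transitions F public

    tag : ∀ {τ} {q q′ : XS k} → Step F τ q q′ → q →sc q′
    tag {τ = control} = inj₂
    tag {τ = system}  = inj₁

    free : ∀ {τ} {q q′ : XS k} → Step None τ q q′ → q →sc q′
    free x = tag (none-any {F = F} x)

    given : {o : XS k₁} → (∀ {k} {q : XS k} → Like o q → F q) →
            ∀ {τ} {q q′ : XS k} → Step (Like o) τ q q′ → q →sc q′
    given f x = tag (mono {G = F} f x)

    module _ (Failing⊆F : ∀ {k} {q : XS k} → Failing q → F q) where

      given′ : {o : XS k₁} → Failing o → ∀ {τ} {q q′ : XS k} → Step (Like o) τ q q′ → q →sc q′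
      given′ f = given λ l → Failing⊆F (Like⇒Failing f l)

      reaches : {q : XS k} → Succeeding q → ReachesSolution q
      reaches (done s)     = _ , ε , s
      reaches (now x s)    = let _ , xs , d = reaches s in _ , free x ◅ xs , d
      reaches (cond f x s) = let _ , xs , d = reaches s in _ , given′ f x ◅ xs , d

      complete : ExcludedMiddle 0ℓ → {p : XS k₁} → TerminatingFrom p → {o : XS k} → Sim o p →
                 ¬ Succeeding o → Failing o
      complete em (acc rs) {o} S n = mk (n ∘ done) first second
        where
        none-≋ : Closed≋ None
        none-≋ _ ()
        like-≋ : ∀ {k} {o : XS k} → Closed≋ (Like o)
        like-≋ e (like e′) = like (≋-trans (≋-sym e) e′)
        first : ∀ {τ o′} → Step None τ o o′ → Failing o′
        first x with simulate none-≋ S x (n ∘ now x ∘ done)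
        ... | _ , _ , y , S′ = complete em (rs (free y)) S′ (n ∘ now x)
        second : ∀ {τ o′ k′} {o₂ : XS k′} → Step (Like o₂) τ o o′ → Succeeding o₂ ⊎ Failing o′
        second {o₂ = o₂} x with em {Succeeding o₂}
        ... | yes s = inj₁ s
        ... | no ¬s with extract x
        ... | inj₁ y = inj₂ (first y)
        ... | inj₂ (_ , _ , y , S₂) with simulate none-≋ S y (n ∘ now y ∘ done)
        ... | _ , _ , z , S₃ with complete em (rs (free z)) (trans S₂ S₃) ¬s
        ... | f with simulate like-≋ S x (n ∘ cond f x ∘ done)
        ... | _ , _ , w , S′ = inj₂ (complete em (rs (given′ f w)) S′ (n ∘ cond f x))

  module _ where
    open Trees Failing

    successor′ : {q q′ : XS k} → Failing q → q →sc q′ → Failing q′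
    successor′ f (inj₁ x) = successor f x
    successor′ f (inj₂ x) = successor f x

    terminating : {q : XS k} → Failing q → TerminatingFrom q
    terminating {q = q} (mk a b d) = acc λ { (inj₁ x) → go x ; (inj₂ x) → go x }
      where
      go : ∀ {τ q′} → Step Failing τ q q′ → TerminatingFrom q′
      go x with split {F = Failing} x
      ... | inj₁ y = terminating (b y)
      ... | inj₂ (_ , _ , f , y) with d y
      ... | inj₁ s = ⊥-elim (disjoint f s)
      ... | inj₂ g = terminating g

    unsolvable : {q : XS k} → Failing q → ¬ ReachesSolution q
    unsolvable (mk a _ _) (_ , ε , s)      = a s
    unsolvable f          (_ , x ◅ xs , s) = unsolvable (successor′ f x) (_ , xs , s)

    semantics : ExcludedMiddle 0ℓ → Semantics 𝓓
    semantics em = record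
      { Fails   = Failing
      ; fails-⇔ = λ q → mk⇔
          (λ f → terminating f , unsolvable f)
          (λ (a , n) → complete (λ f → f) em a (eqv ≋-refl) (n ∘ reaches (λ f → f)))
      }

  module _ (em : ExcludedMiddle 0ℓ) (𝓢 : Semantics 𝓓) where
    open Semantics 𝓢 using (Fails; fails-⇔)
    open Trees Fails

    private
      to : {q : XS k} → Fails q → TerminatingFrom q × ¬ ReachesSolution q
      to = Equivalence.to (fails-⇔ _)

      from : {q : XS k} → TerminatingFrom q × ¬ ReachesSolution q → Fails q
      from = Equivalence.from (fails-⇔ _)

    resp-sc : {q q₁ q′ : XS k} → q ≋ q₁ → q₁ →sc q′ → q →sc q′
    resp-sc e (inj₁ x) = inj₁ (resp e x ≋-refl)
    resp-sc e (inj₂ x) = inj₂ (resp e x ≋-refl)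

    Fails-≋ : {q q′ : XS k} → q ≋ q′ → Fails q → Fails q′
    Fails-≋ {q = q} {q′} e f with to f
    ... | acc rs , n = from (acc (λ x → rs (resp-sc e x)) , n′)
      where
      n′ : ¬ ReachesSolution q′
      n′ (_ , ε , s)      = n (_ , ε , Solution-≋ (≋-sym e) s)
      n′ (_ , x ◅ xs , s) = n (_ , resp-sc e x ◅ xs , s)

    Like⇒Fails : {o : XS k} → Fails o → {q : XS k₁} → Like o q → Fails q
    Like⇒Fails f (like e) = Fails-≋ (≋-sym e) f

    mutual
      Failing⇒Fails : {q : XS k} → Failing q → Fails q
      Failing⇒Fails {q = q} (mk a b d) = from (acc (λ x → to (next x) .proj₁) , unsolv)
        where
        go : ∀ {τ q′} → Step Fails τ q q′ → Fails q′
        go x with split {F = Fails} x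
        ... | inj₁ y = Failing⇒Fails (b y)
        ... | inj₂ (_ , _ , f , y) with d y
        ... | inj₁ s = ⊥-elim (to f .proj₂ (Succeeding⇒Reaches s))
        ... | inj₂ g = Failing⇒Fails g
        next : ∀ {q′} → q →sc q′ → Fails q′
        next (inj₁ x) = go x
        next (inj₂ x) = go x
        unsolv : ¬ ReachesSolution q
        unsolv (_ , ε , s)      = a s
        unsolv (_ , x ◅ xs , s) = to (next x) .proj₂ (_ , xs , s)

      Succeeding⇒Reaches : {q : XS k} → Succeeding q → ReachesSolution q
      Succeeding⇒Reaches (done s)     = _ , ε , s
      Succeeding⇒Reaches (now x s)    =
        let _ , xs , d = Succeeding⇒Reaches s in _ , free x ◅ xs , d
      Succeeding⇒Reaches (cond f x s) =
        let _ , xs , d = Succeeding⇒Reaches s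
            o-fails    = Failing⇒Fails f
        in _ , given (Like⇒Fails o-fails) x ◅ xs , d

    Fails⇔Failing : (q : XS k) → Fails q ⇔ Failing q
    Fails⇔Failing q = mk⇔
      (λ f → let a , n = to f in
             complete Failing⇒Fails em a (eqv ≋-refl) (n ∘ Succeeding⇒Reaches))
      Failing⇒Fails

  unique : ExcludedMiddle 0ℓ → (𝓢 𝓢′ : Semantics 𝓓) (q : XS k) →
           Semantics.Fails 𝓢 q ⇔ Semantics.Fails 𝓢′ q
  unique em 𝓢 𝓢′ q = mk⇔
    (λ f → Equivalence.from (Fails⇔Failing em 𝓢′ q) (Equivalence.to (Fails⇔Failing em 𝓢 q) f))
    (λ f → Equivalence.from (Fails⇔Failing em 𝓢 q) (Equivalence.to (Fails⇔Failing em 𝓢′ q) f))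

{-# OPTIONS --safe #-}

-- Modulo ≋ the relation ↠ is a finite graph below t ＠ α,
-- and cterm is a labelling of its nodes.  It serves as an automaton reading at
-- each node the label of that node: all infinite paths are accepted, and finite
-- ones are when they end in a node from which control transitions reach a
-- solution.  The infinite words are hence unconstrained by acceptance, and
-- closedness is König's lemma.
module Submission where

open import Defs
open import Axiom.ExcludedMiddle using (ExcludedMiddle)
open import Data.Bool using (true)
open import Data.Empty using (⊥)
open import Data.Fin using (Fin; zero; suc)
open import Data.Fin.Subset using (Subset; _∈_; ⊤; ⁅_⁆)
open import Data.Fin.Subset.Properties using (∈⊤; x∈⁅x⁆; x∈⁅y⁆⇒x≡y)
open import Data.List using (List; []; _∷_; map; applyUpTo; length; lookup; deduplicate)
open import Data.List.Membership.Propositional renaming (_∈_ to _∈ₗ_)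
open import Data.List.Membership.Propositional.Properties using (∈-lookup)
open import Data.List.Relation.Binary.Pointwise as Pointwise using (Pointwise; []; _∷_)
open import Data.List.Relation.Binary.Prefix.Heterogeneous using (Prefix; []; _∷_)
open import Data.List.Relation.Unary.All as All using (All; []; _∷_)
open import Data.List.Relation.Unary.AllPairs using (_∷_)
open import Data.List.Relation.Unary.Any as Any using (Any)
import Data.List.Relation.Unary.Any.Properties as Any
import Data.List.Relation.Unary.Unique.Setoid as Unique
open import Data.List.Relation.Unary.Unique.DecSetoid.Properties using (deduplicate-!)
open import Data.Maybe as Maybe using (just)
open import Data.Nat using (ℕ; zero; suc; _≤_; _≤′_; ≤′-refl; ≤′-step; _⊔_)
open import Data.Nat.Properties using (≤-refl; m≤m⊔n; m≤n⊔m; ≤⇒≤′)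
open import Data.Product using (Σ-syntax; ∃-syntax; _×_; _,_; proj₁; proj₂)
open import Data.Sum using (inj₁; inj₂)
import Data.Vec as Vec
open import Data.Vec.Properties using (lookup⇒[]=; []=⇒lookup; lookup∘tabulate)
open import Function.Base using (_∘_; id)
open import Function.Bundles using (mk⇔)
open import Function.Definitions using (Injective)
open import Level using (0ℓ)
open import Relation.Binary.Bundles using (Setoid; DecSetoid)
open import Relation.Binary.Construct.Closure.ReflexiveTransitive as Star
  using (Star; ε; _◅_; _◅◅_)
open import Relation.Binary.PropositionalEquality as ≡ using (_≡_; refl)
open import Relation.Nullary using (¬_; yes; no; does; contradiction; Dec)
open import Relation.Nullary.Decidable using (dec-true; decidable-stable)

-- Classical finite combinatorics: enumeration modulo an equivalence, and pigeonhole.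

module _ (S : Setoid 0ℓ 0ℓ) where
  open Setoid S using (_≈_; sym)

  lookup-injective : ∀ {xs} → Unique.Unique S xs → Injective _≡_ _≈_ (lookup xs)
  lookup-injective (_ ∷ _)  {zero}  {zero}  _ = refl
  lookup-injective (p ∷ _)  {zero}  {suc j} e = contradiction e (All.lookup p (∈-lookup j))
  lookup-injective (p ∷ _)  {suc i} {zero}  e = contradiction (sym e) (All.lookup p (∈-lookup i))
  lookup-injective (_ ∷ ps) {suc i} {suc j} e = ≡.cong suc (lookup-injective ps e)

module Classical (em : ExcludedMiddle 0ℓ) where

  -- `Automaton` asks for Boolean subsets, whereas edges and initial nodes are given by arbitrary
  -- propositions; excluded middle decides them.
  subset : ∀ {n} → (Fin n → Set) → Subset n
  subset P = Vec.tabulate λ i → does (em {P i})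

  ∈-subset⁺ : ∀ {n} (P : Fin n → Set) {i} → P i → i ∈ subset P
  ∈-subset⁺ P {i} p =
    lookup⇒[]= i _ (≡.trans (lookup∘tabulate _ i) (dec-true (em {P i}) p))

  ∈-subset⁻ : ∀ {n} (P : Fin n → Set) {i} → i ∈ subset P → P i
  ∈-subset⁻ P {i} i∈ = witness em (≡.trans (≡.sym (lookup∘tabulate _ i)) ([]=⇒lookup i∈))
    where
    witness : ∀ {A : Set} (d : Dec A) → does d ≡ true → A
    witness (yes a) _ = a

  AntitoneFamily : ∀ {n} → (Fin n → ℕ → Set) → Set
  AntitoneFamily P = ∀ {i m n} → m ≤ n → P i n → P i m

  -- If index `zero` fails at some bound, antitonicity makes it fail at everything above. So for any
  -- `m`, an index found at the maximum of `m` and that bound lies among the others, and it still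
  -- works at `m`. This is the choice of a branch in König's lemma.
  pigeonhole : ∀ {n} (P : Fin n → ℕ → Set) → AntitoneFamily P →
               (∀ m → ∃[ i ] P i m) → ∃[ i ] ∀ m → P i m
  pigeonhole {zero}  P anti h = contradiction (proj₁ (h 0)) λ ()
  pigeonhole {suc n} P anti h with em {∀ m → P zero m}
  ... | yes p = zero , p
  ... | no ¬p = let i , p = pigeonhole (P ∘ suc) anti later in suc i , p
    where
    bound : ∃[ m ] ¬ P zero m
    bound = decidable-stable em λ ¬b → ¬p λ m → decidable-stable em λ ¬Pm → ¬b (m , ¬Pm)

    later : ∀ m → ∃[ i ] P (suc i) m
    later m with h (m ⊔ proj₁ bound)
    ... | zero  , p = contradiction (anti (m≤n⊔m m _) p) (proj₂ bound)
    ... | suc i , p = i , anti (m≤m⊔n m _) p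

  module _ (S : Setoid 0ℓ 0ℓ) where
    open Setoid S using (_≈_; sym; trans; isEquivalence) renaming (Carrier to A)

    private
      decSetoid : DecSetoid 0ℓ 0ℓ
      decSetoid = record
        { isDecEquivalence = record { isEquivalence = isEquivalence ; _≟_ = λ _ _ → em } }

    -- Builds the alphabet: duplicates modulo `_≈_` are removed because letters have to be presented
    -- injectively.
    enumerate : (xs : List A) →
                ∃[ m ] Σ[ f ∈ (Fin m → A) ] Injective _≡_ _≈_ f ×
                  (∀ {x} → Any (x ≈_) xs → ∃[ i ] x ≈ f i)
    enumerate xs =
      length ys , lookup ys , lookup-injective S (deduplicate-! decSetoid xs) ,
      λ x∈xs → let x∈ys = Any.deduplicate⁺ _≟_ (λ e e′ → trans e′ (sym e)) x∈xs
               in Any.index x∈ys , Any.lookup-index x∈ys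
      where
      open DecSetoid decSetoid using (_≟_)
      ys = deduplicate _≟_ xs

-- Stability of equational deduction under substitution.

module Substitutivity (𝓔 : EquationalTheory) where
  open EquationalTheory 𝓔

  private variable
    k   : Kind
    ks  : List Kind
    X Y : Family

  module _ (f : ∀ {k} → X k → Term Y k) where

    instantiate : Substitution X → Substitution Y
    instantiate σ k x = Maybe.map (bind f) (σ k x)

    mutual
      bind-↦ : ∀ {σ} {u : Pattern k} {t} → σ ⊢ u ↦ t → instantiate σ ⊢ u ↦ bind f t
      bind-↦ (var e) = var (≡.cong (Maybe.map (bind f)) e)
      bind-↦ (op es) = op (binds-↦ es)

      binds-↦ : ∀ {σ : Substitution X} {us : Args Var ks} {ts} →
                Insts (λ x t → σ _ x ≡ just t) us ts →
                Insts (λ x t → instantiate σ _ x ≡ just t) us (binds f ts)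
      binds-↦ []       = []
      binds-↦ (e ∷ es) = bind-↦ e ∷ binds-↦ es

    mutual
      -- An instance of an axiom under `σ` is sent to its instance under `instantiate σ`. Axioms are
      -- conditional, so memberships and conditions are carried along in the same induction.
      bind-≈ : {t u : Term X k} → t ≈ u → bind f t ≈ bind f u
      bind-≈ refl            = refl
      bind-≈ (sym e)         = sym (bind-≈ e)
      bind-≈ (trans e e′)    = trans (bind-≈ e) (bind-≈ e′)
      bind-≈ (cong g es)     = cong g (binds-≈ es)
      bind-≈ (ax σ a hs l r) = ax (instantiate σ) a (bind-All hs) (bind-↦ l) (bind-↦ r)

      binds-≈ : {ts us : Args X ks} → ts ≈* us → binds f ts ≈* binds f us
      binds-≈ []       = []
      binds-≈ (e ∷ es) = bind-≈ e ∷ binds-≈ es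

      bind-HasSort : {t : Term X k} {s : Sort k} → HasSort t s → HasSort (bind f t) s
      bind-HasSort (resp e h)    = resp (bind-≈ e) (bind-HasSort h)
      bind-HasSort (ax σ a hs i) = ax (instantiate σ) a (bind-All hs) (bind-↦ i)

      bind-Holds : ∀ {σ : Substitution X} {A} → Holds σ A → Holds (instantiate σ) A
      bind-Holds (eq l r e) = eq (bind-↦ l) (bind-↦ r) (bind-≈ e)
      bind-Holds (mem i h)  = mem (bind-↦ i) (bind-HasSort h)

      bind-All : ∀ {σ : Substitution X} {C} → Satisfies σ C → Satisfies (instantiate σ) C
      bind-All []       = []
      bind-All (h ∷ hs) = bind-Holds h ∷ bind-All hs

  module _ {f g : ∀ {k} → X k → Term Y k} (f≈g : ∀ {k} (x : X k) → f x ≈ g x) where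
    mutual
      bind-cong : (t : Term X k) → bind f t ≈ bind g t
      bind-cong (var x)   = f≈g x
      bind-cong (op h ts) = cong h (binds-cong ts)

      binds-cong : (ts : Args X ks) → binds f ts ≈* binds g ts
      binds-cong []       = []
      binds-cong (t ∷ ts) = bind-cong t ∷ binds-cong ts

-- Invariance of labels and executions under equality of states.

module Executions {𝓡 : RewriteTheory} {𝓓 : StrategyDefinitions 𝓡} (𝓢 : Semantics 𝓓) where
  open RewriteTheory 𝓡
  open Semantics 𝓢
  open Substitutivity equational

  private variable
    k : Kind

  mutual
    cterm-cong : {q q′ : XS k} → q ≋ q′ → cterm q ≈ cterm q′
    cterm-cong (e ＠ _)                   = e
    cterm-cong (subterm {t′ = t′} es e _)  =
      -- First the term around the subterms is exchanged, then the current terms put into it.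
      trans (bind-≈ _ e) (bind-cong (λ (_ , i) → cterms-cong es i) t′)
    cterm-cong (rewc _ _ _ _ e _)         = e

    cterms-cong : ∀ {xs x} {qs qs′ : All (λ y → XS (proj₁ y)) xs} → qs ≋* qs′ →
                  (i : x ∈ₗ xs) → cterms qs i ≈ cterms qs′ i
    cterms-cong (e ∷ es) (Any.here refl) = cterm-cong e
    cterms-cong (e ∷ es) (Any.there i)   = cterms-cong es i

  -- The rule `resp` absorbs the equivalence into the first transition, which is the system one if
  -- no control transition precedes it.
  ↠-respˡ : {q p q′ : XS k} → q ≋ p → p ↠ q′ → q ↠ q′
  ↠-respˡ e (_ , ε , x)      = _ , ε , resp e x ≋-refl
  ↠-respˡ e (_ , y ◅ ys , x) = _ , resp e y ≋-refl ◅ ys , x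

  ↠-respʳ : {q q′ p : XS k} → q ↠ q′ → q′ ≋ p → q ↠ p
  ↠-respʳ (_ , ys , x) e = _ , ys , resp ≋-refl x e

  ↠⇒→sc* : {q q′ : XS k} → q ↠ q′ → Star _→sc_ q q′
  ↠⇒→sc* (_ , ys , x) = Star.map inj₂ ys ◅◅ inj₁ x ◅ ε

  Final : XS k → Set
  Final q = ∃[ q′ ] Star _→c_ q q′ × Solution q′

  Final-resp : {q p : XS k} → q ≋ p → Final p → Final q
  Final-resp e (_ , ε , s)      = _ , ε , Solution-≋ (≋-sym e) s
  Final-resp e (_ , y ◅ ys , s) = _ , resp e y ≋-refl ◅ ys , s

  Pointwise-trans : {us vs ws : List (Ground k)} →
                    Pointwise _≈_ us vs → Pointwise _≈_ vs ws → Pointwise _≈_ us ws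
  Pointwise-trans = Pointwise.transitive trans

  FiniteFrom : XS k → List (Ground k) → Set
  FiniteFrom q w = ∃[ qs ] Finite q qs × Pointwise _≈_ w (map cterm qs)

  -- Executions begin in exactly the given state, not just modulo `_≋_`. Only the first state is
  -- exchanged; the later ones stay.
  FiniteFrom-resp : ∀ {q p : XS k} {w} → q ≋ p → FiniteFrom p w → FiniteFrom q w
  FiniteFrom-resp e (_ , stop ys s , a ∷ as) =
    let _ , ys′ , s′ = Final-resp e (_ , ys , s)
    in _ , stop ys′ s′ , trans a (cterm-cong (≋-sym e)) ∷ as
  FiniteFrom-resp e (_ , step x r , a ∷ as) =
    _ , step (↠-respˡ e x) r , trans a (cterm-cong (≋-sym e)) ∷ as

  -- The finite graph of reachable states.

  module Reachable (em : ExcludedMiddle 0ℓ) {q₀ : XS k} (fin : FinitelyManyReachable q₀) where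
    open Classical em

    Reached : XS k → Set
    Reached = Star _→sc_ q₀

    reached-↠ : ∀ {q q′} → Reached q → q ↠ q′ → Reached q′
    reached-↠ r x = r ◅◅ ↠⇒→sc* x

    size : ℕ
    size = length (proj₁ fin)

    state : Fin size → XS k
    state = lookup (proj₁ fin)

    -- The node is chosen from the derivation `r`, and the list may repeat itself modulo `_≋_`.
    -- Nodes are therefore compared with states only through `state-index`.
    index : ∀ {q} → Reached q → Fin size
    index r = Any.index (proj₂ fin r)

    state-index : ∀ {q} (r : Reached q) → q ≋ state (index r)
    state-index r = Any.lookup-index (proj₂ fin r)

    -- König's lemma for traces.

    -- n steps can be made from q reading the first n + 1 letters of w.
    data Trace : ℕ → XS k → (ℕ → Ground k) → Set where
      last : ∀ {q w} → w 0 ≈ cterm q → Trace zero q w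
      next : ∀ {n q w p} → w 0 ≈ cterm q → q ↠ state p → Trace n (state p) (w ∘ suc) →
             Trace (suc n) q w

    trace-pred : ∀ {n q w} → Trace (suc n) q w → Trace n q w
    trace-pred (next e x (last _))       = last e
    trace-pred (next e x y@(next _ _ _)) = next e x (trace-pred y)

    trace-antitone : ∀ {m n q w} → m ≤ n → Trace n q w → Trace m q w
    trace-antitone = go ∘ ≤⇒≤′
      where
      go : ∀ {m n q w} → m ≤′ n → Trace n q w → Trace m q w
      go ≤′-refl     = id
      go (≤′-step l) = go l ∘ trace-pred

    trace-resp : ∀ {n q p w} → q ≋ p → Trace n p w → Trace n q w
    trace-resp e (last a)     = last (trans a (cterm-cong (≋-sym e)))
    trace-resp e (next a x y) = next (trans a (cterm-cong (≋-sym e))) (↠-respˡ e x) y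

    -- Replaces the successor by its representative in the list, so that each trace runs through
    -- finitely many nodes, as the pigeonhole argument requires.
    trace-step : ∀ {n q q′ w} → w 0 ≈ cterm q → q ↠ q′ → Reached q′ →
                 Trace n q′ (w ∘ suc) → Trace (suc n) q w
    trace-step e x r y =
      next e (↠-respʳ x (state-index r)) (trace-resp (≋-sym (state-index r)) y)

    finite-trace : ∀ n {q qs u w} → Reached q → Finite q qs → Pointwise _≈_ u (map cterm qs) →
                   Prefix _≈_ (applyUpTo w (suc n)) u → Trace n q w
    finite-trace zero    r (stop _ _) (a ∷ _)  (b ∷ _)  = last (trans b a)
    finite-trace zero    r (step _ _) (a ∷ _)  (b ∷ _)  = last (trans b a)
    -- An execution that stops here has one letter left, but the prefix has at least two.
    finite-trace (suc n) r (stop _ _) (_ ∷ []) (_ ∷ ())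
    finite-trace (suc n) r (step x f) (a ∷ as) (b ∷ bs) =
      let r′ = reached-↠ r x in trace-step (trans b a) x r′ (finite-trace n r′ f as bs)

    infinite-trace : ∀ n {qs : ℕ → XS k} {v w} → Reached (qs 0) → (∀ i → qs i ↠ qs (suc i)) →
                     (∀ i → v i ≈ cterm (qs i)) →
                     Pointwise _≈_ (applyUpTo w (suc n)) (applyUpTo v (suc n)) → Trace n (qs 0) w
    infinite-trace zero    r xs as (b ∷ _)  = last (trans b (as 0))
    infinite-trace (suc n) {w = w} r xs as (b ∷ bs) =
      let r′ = reached-↠ r (xs 0)
      in trace-step (trans b (as 0)) (xs 0) r′
                    (infinite-trace n {w = w ∘ suc} r′ (xs ∘ suc) (as ∘ suc) bs)

    Traceable : XS k → (ℕ → Ground k) → Set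
    Traceable q w = ∀ n → Trace n q w

    -- For each `n` some successor node has a trace of length `n`. As the nodes are finite in number
    -- and traces can be shortened, a single successor serves all `n`.
    continue : ∀ {q w} → Traceable q w → ∃[ p ] q ↠ state p × Traceable (state p) (w ∘ suc)
    continue {q} {w} f =
      let p , h = pigeonhole (λ p n → q ↠ state p × Trace n (state p) (w ∘ suc))
                             (λ l (x , y) → x , trace-antitone l y)
                             (λ n → first (f (suc n)))
      -- The edge is the same fact for every `n`, so it can be read off at 0.
      in p , proj₁ (h 0) , proj₂ ∘ h
      where
      first : ∀ {n} → Trace (suc n) q w → ∃[ p ] q ↠ state p × Trace n (state p) (w ∘ suc)
      first (next _ x y) = _ , x , y

    path : ∀ {q w} → Traceable q w → ℕ → XS k
    path {q} f zero    = q
    path     f (suc i) = path (proj₂ (proj₂ (continue f))) i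

    path-↠ : ∀ {q w} (f : Traceable q w) i → path f i ↠ path f (suc i)
    path-↠ f zero    = proj₁ (proj₂ (continue f))
    path-↠ f (suc i) = path-↠ (proj₂ (proj₂ (continue f))) i

    path-label : ∀ {q w} (f : Traceable q w) i → w i ≈ cterm (path f i)
    path-label f zero    with last e ← f 0 = e
    path-label f (suc i) = path-label (proj₂ (proj₂ (continue f))) i

    -- The alphabet and the two automata.

    private
      alphabet = enumerate (termSetoid (λ _ → ⊥) k) (map cterm (proj₁ fin))

    m : ℕ
    m = proj₁ alphabet

    letter : Fin m → Ground k
    letter = proj₁ (proj₂ alphabet)

    letter-injective : Injective _≡_ _≈_ letter
    letter-injective = proj₁ (proj₂ (proj₂ alphabet))

    letterOf : ∀ {q} → Reached q → ∃[ a ] cterm q ≈ letter a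
    letterOf r = proj₂ (proj₂ (proj₂ alphabet)) (Any.map⁺ (Any.map cterm-cong (proj₂ fin r)))

    -- zero is a sink entered after the last letter of a finite word.
    Successor : XS k → Fin (suc size) → Set
    Successor q zero    = Final q
    Successor q (suc p) = q ↠ state p

    -- An edge reads the label of its source. An execution has one letter more than it has steps,
    -- and the edge into the sink reads that last one. The sink has no outgoing edge, so no infinite
    -- run enters it.
    Edge : Fin (suc size) → Fin m → Fin (suc size) → Set
    Edge zero    a p′ = ⊥
    Edge (suc p) a p′ = letter a ≈ cterm (state p) × Successor (state p) p′

    Initial : Fin (suc size) → Set
    Initial zero    = ⊥
    Initial (suc p) = q₀ ≋ state p

    automaton : Subset (suc size) → Automaton m
    automaton accepting = record
      { size      = suc size
      ; initial   = subset Initial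
      ; accepting = accepting
      ; δ         = λ p a → subset (Edge p a)
      }

    nfa büchi : Automaton m
    nfa   = automaton ⁅ zero ⁆
    büchi = automaton ⊤

    -- The transitions do not depend on the accepting set, so this applies to `büchi` as well.
    edge⁺ : ∀ {p a p′} → Edge p a p′ → p′ ∈ Automaton.δ nfa p a
    edge⁺ {p} {a} = ∈-subset⁺ (Edge p a)

    edge⁻ : ∀ p {a p′} → p′ ∈ Automaton.δ nfa p a → Edge p a p′
    edge⁻ p {a} = ∈-subset⁻ (Edge p a)

    open Automaton nfa using (Accepts; []; _∷_)

    -- An accepting run ends in the sink, and its edge into the sink carries the control transitions
    -- to a solution.
    accepts⇒finite : ∀ {p v} → Accepts (suc p) v → FiniteFrom (state p) (map letter v)
    accepts⇒finite ([] s) with () ← x∈⁅y⁆⇒x≡y zero s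
    accepts⇒finite {p} (_∷_ {q = zero} x ([] _)) =
      let e , _ , ys , s = edge⁻ (suc p) x in _ , stop ys s , e ∷ []
    accepts⇒finite (_∷_ {q = zero} _ (_∷_ {a} x _)) with () ← edge⁻ zero {a} x
    accepts⇒finite {p} (_∷_ {q = suc p′} x r) =
      let e , y      = edge⁻ (suc p) x
          _ , f , es = accepts⇒finite r
      in _ , step y f , e ∷ es

    -- The run visits representatives of the states of the execution; `q ≋ state p` is the invariant
    -- that links the two.
    finite⇒accepts : ∀ {q p qs} → Reached q → q ≋ state p → Finite q qs →
                     ∃[ v ] Pointwise _≈_ (map cterm qs) (map letter v) × Accepts (suc p) v
    finite⇒accepts r e (stop ys s) =
      let a , h = letterOf r
      in _ , h ∷ [] ,
         edge⁺ (trans (sym h) (cterm-cong e) , Final-resp (≋-sym e) (_ , ys , s)) ∷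
         [] (x∈⁅x⁆ zero)
    finite⇒accepts r e (step x f) =
      let a , h       = letterOf r
          r′          = reached-↠ r x
          v , es , ac = finite⇒accepts r′ (state-index r′) f
      in a ∷ v , h ∷ es ,
         edge⁺ (trans (sym h) (cterm-cong e) ,
                ↠-respˡ (≋-sym e) (↠-respʳ x (state-index r′))) ∷ ac

    recognises⇒finite : ∀ {w v} → Pointwise _≈_ w (map letter v) → Automaton.Recognises nfa v →
                        FiniteFrom q₀ w
    recognises⇒finite es (zero , i , _) with () ← ∈-subset⁻ Initial i
    recognises⇒finite es (suc p , i , r) =
      let qs , f , es′ = FiniteFrom-resp (∈-subset⁻ Initial i) (accepts⇒finite r)
      in qs , f , Pointwise-trans es es′

    finite⇒recognises : ∀ {w} → FiniteFrom q₀ w →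
                        ∃[ v ] Pointwise _≈_ w (map letter v) × Automaton.Recognises nfa v
    finite⇒recognises (_ , f , es) =
      let v , es′ , r = finite⇒accepts ε (state-index ε) f
      in v , Pointwise-trans es es′ ,
         suc (index ε) , ∈-subset⁺ Initial (state-index ε) , r

    InfiniteFrom : (ℕ → Ground k) → Set
    InfiniteFrom w = Σ[ qs ∈ (ℕ → XS k) ]
      (qs 0 ≡ q₀ × (∀ i → qs i ↠ qs (suc i))) × (∀ i → w i ≈ cterm (qs i))

    accumulation⇒infinite : ∀ {w} → Traceable q₀ w → InfiniteFrom w
    accumulation⇒infinite f = path f , (refl , path-↠ f) , path-label f

    infinite⇒büchi : ∀ {w} → InfiniteFrom w →
                     Σ[ v ∈ (ℕ → Fin m) ] (∀ i → w i ≈ letter (v i)) ×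
                                          Automaton.BüchiRecognises büchi v
    infinite⇒büchi {w} (qs , (refl , xs) , es) =
      proj₁ ∘ label , (λ i → trans (es i) (proj₂ (label i))) ,
      suc ∘ node , ∈-subset⁺ Initial (state-index ε) , edges , λ i → i , ≤-refl , ∈⊤
      where
      reach : ∀ i → Reached (qs i)
      reach zero    = ε
      reach (suc i) = reached-↠ (reach i) (xs i)

      label : ∀ i → ∃[ a ] cterm (qs i) ≈ letter a
      label i = letterOf (reach i)

      node : ℕ → Fin size
      node i = index (reach i)

      node-≋ : ∀ i → qs i ≋ state (node i)
      node-≋ i = state-index (reach i)

      edges : ∀ i → suc (node (suc i)) ∈ Automaton.δ büchi (suc (node i)) (proj₁ (label i))
      edges i = edge⁺ ( trans (sym (proj₂ (label i))) (cterm-cong (node-≋ i))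
                      , ↠-respˡ (≋-sym (node-≋ i)) (↠-respʳ (xs i) (node-≋ (suc i))))

    büchi⇒infinite : ∀ {w} {v : ℕ → Fin m} → (∀ i → w i ≈ letter (v i)) →
                     Automaton.BüchiRecognises büchi v → InfiniteFrom w
    büchi⇒infinite {w} {v} es (ρ , ρ₀ , ρ-step , _) = qs , (refl , xs) , labels
      where
      -- Every state of an infinite run has an outgoing edge, unlike the sink.
      nonsink : ∀ i → ∃[ p ] ρ i ≡ suc p
      nonsink i with ρ i | edge⁻ (ρ i) {v i} (ρ-step i)
      ... | suc p | _ = p , refl

      edge : ∀ i → letter (v i) ≈ cterm (state (proj₁ (nonsink i))) ×
                   state (proj₁ (nonsink i)) ↠ state (proj₁ (nonsink (suc i)))
      -- The two states of the run are generalised to variables, so that their equations can be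
      -- matched and `Edge` reduces.
      edge i = go (proj₂ (nonsink i)) (proj₂ (nonsink (suc i))) (edge⁻ (ρ i) {v i} (ρ-step i))
        where
        go : ∀ {p p′ q q′} → p ≡ suc q → p′ ≡ suc q′ → Edge p (v i) p′ →
             letter (v i) ≈ cterm (state q) × state q ↠ state q′
        go refl refl x = x

      start-≋ : q₀ ≋ state (proj₁ (nonsink 0))
      start-≋ = ≡.subst Initial (proj₂ (nonsink 0)) (∈-subset⁻ Initial ρ₀)

      -- The execution has to start in `q₀` itself, whereas the run starts in a node merely
      -- equivalent to it; hence the exception at position 0.
      qs : ℕ → XS k
      qs zero    = q₀
      qs (suc i) = state (proj₁ (nonsink (suc i)))

      xs : ∀ i → qs i ↠ qs (suc i)
      xs zero    = ↠-respˡ start-≋ (proj₂ (edge 0))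
      xs (suc i) = proj₂ (edge (suc i))

      labels : ∀ i → w i ≈ cterm (qs i)
      labels zero    = trans (es 0) (trans (proj₁ (edge 0)) (cterm-cong (≋-sym start-≋)))
      labels (suc i) = trans (es (suc i)) (proj₁ (edge (suc i)))

  -- Closedness and regularity of `E α t`.

  module _ (em : ExcludedMiddle 0ℓ) (α : Strat) (t : Ground k)
           (fin : FinitelyManyReachable (start α t)) where
    open Reachable em fin

    E-closed : Closed (E α t)
    -- A trace of `n` steps reads `n + 1` letters, hence the prefix of length `suc n`.
    E-closed w acc = accumulation⇒infinite λ n → trace n (acc (suc n))
      where
      trace : ∀ n → HasPrefix (E α t) w (suc n) → Trace n (start α t) w
      trace n (inj₁ (_ , (_ , f , as) , bs)) = finite-trace n ε f as bs
      trace n (inj₂ (_ , (qs , (e , xs) , as) , bs)) =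
        ≡.subst (λ q → Trace n q w) e
                (infinite-trace n {qs} (≡.subst Reached (≡.sym e) ε) xs as bs)

    E-∞-regular : ∞-Regular (E α t)
    E-∞-regular = record
      { letter           = letter
      ; letter-injective = letter-injective
      ; nfa              = nfa
      ; regular          = λ w → mk⇔ finite⇒recognises λ (_ , es , r) → recognises⇒finite es r
      ; büchi            = büchi
      ; ω-regular        = λ w → mk⇔ infinite⇒büchi λ (_ , es , r) → büchi⇒infinite es r
      }

proposition4 :
  ExcludedMiddle 0ℓ →
  (𝓡 : RewriteTheory) (𝓓 : StrategyDefinitions 𝓡) (𝓢 : Semantics 𝓓) →
  let open RewriteTheory 𝓡
      open Semantics 𝓢
  in ∀ {k} (α : Strat) (t : Ground k) →
     FinitelyManyReachable (start α t) →
     Closed (E α t) × ∞-Regular (E α t)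
proposition4 em 𝓡 𝓓 𝓢 α t fin = E-closed em α t fin , E-∞-regular em α t fin
  where open Executions 𝓢
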